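{- Let $a,b,c\in\mathbb{Q}$ with $abc\neq 0$, $ac-b^2\neq0$, $3ac-b^2\neq0$ and $4ac-b^2\neq0$, and let \[\mathcal{E}_4:\ Y^2=X^3-3a^6c^2X-a^6(2ac-b^2)(a^2c^2-4ab^2c+b^4)\] over $\mathbb{Q}$. If $b^2\neq \tfrac32 ac$, then $\mathcal{E}_4(\mathbb{Q})$ has positive rank. If $b^2=\tfrac32 ac$, then $\mathcal{E}_4(\mathbb{Q})$ has rank $0$. -}

module Defs where

open import Data.Nat using (ℕ; zero; suc)
open import Data.Integer using (+_)
open import Data.Rational using (ℚ; 0ℚ; _+_; _*_; _-_; -_; _/_; _÷_; ≢-nonZero)
open import Data.Rational.Properties using (_≟_)
open import Data.Product using (Σ-syntax; _×_)
open import Data.Unit using (⊤)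
open import Relation.Binary.PropositionalEquality using (_≡_; _≢_)
open import Relation.Nullary using (yes; no)

ℚ[_] : ℕ → ℚ
ℚ[ n ] = + n / 1

-- Points of a Weierstrass curve  E : Y² = X³ + A X + B  over ℚ
-- (projective closure): the point at infinity O, or an affine point (x , y).
data Point : Set where
  O  : Point
  pt : ℚ → ℚ → Point

OnCurve : ℚ → ℚ → Point → Set
OnCurve A B O        = ⊤
OnCurve A B (pt x y) = y * y ≡ x * x * x + A * x + B

-- third intersection point, reflected, for the line of slope l through (x₁,y₁), (x₂,y₂)
chord : ℚ → ℚ → ℚ → ℚ → Point
chord l x₁ y₁ x₂ = let x₃ = l * l - x₁ - x₂ in pt x₃ (l * (x₁ - x₃) - y₁)

-- The chord-tangent group law on E(ℚ) (identity O, depends only on A),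
-- standard formulas.  For x₁ = x₂ and y₁ + y₂ ≠ 0 (on the curve this forces
-- y₁ = y₂ ≠ 0) the tangent slope (3x₁² + A)/(2y₁) is written (3x₁² + A)/(y₁ + y₂).
add : ℚ → Point → Point → Point
add A O Q = Q
add A (pt x₁ y₁) O = pt x₁ y₁
add A (pt x₁ y₁) (pt x₂ y₂) with (x₂ - x₁) ≟ 0ℚ
... | no d≢0 =
  let instance _ = ≢-nonZero d≢0
  in chord ((y₂ - y₁) ÷ (x₂ - x₁)) x₁ y₁ x₂
... | yes _ with (y₁ + y₂) ≟ 0ℚ
...   | yes _ = O
...   | no s≢0 =
  let instance _ = ≢-nonZero s≢0
  in chord ((ℚ[ 3 ] * x₁ * x₁ + A) ÷ (y₁ + y₂)) x₁ y₁ x₂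

mul : ℚ → ℕ → Point → Point
mul A zero    P = O
mul A (suc n) P = add A P (mul A n P)

InfiniteOrder : ℚ → Point → Set
InfiniteOrder A P = (n : ℕ) → mul A (suc n) P ≢ O

PositiveRank : ℚ → ℚ → Set
PositiveRank A B = Σ[ P ∈ Point ] (OnCurve A B P × InfiniteOrder A P)

-- E(ℚ) has rank 0: (E(ℚ) being finitely generated) every point is torsion.
RankZero : ℚ → ℚ → Set
RankZero A B = (P : Point) → OnCurve A B P → Σ[ n ∈ ℕ ] mul A (suc n) P ≡ O

a⁶ : ℚ → ℚ
a⁶ a = a * a * a * a * a * a

E₄-A : ℚ → ℚ → ℚ → ℚ
E₄-A a b c = - (ℚ[ 3 ] * a⁶ a * c * c)

E₄-B : ℚ → ℚ → ℚ → ℚ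
E₄-B a b c = - (a⁶ a * (ℚ[ 2 ] * a * c - b * b)
                    * (a * a * c * c - ℚ[ 4 ] * a * b * b * c + b * b * b * b))

{-# OPTIONS --safe #-}

-- Put p / q = 3 a c / b² and shrink X and Y: E₄ becomes y² = x³ − p q x² + (p − q)² q⁴, with the point
-- P = (0 , (p − q) q²). The value p / q = 2 is the second case.
--
-- Positive rank: if p / q ≠ 2, one of 3 P, 4 P, 6 P lies in the kernel of reduction modulo some N > 1 (not
-- necessarily prime). In the coordinate z = x / y, adding such a point Q moves z by z(Q) up to a factor
-- 1 + O(N), and this displacement depends on z in a Lipschitz way with constant divisible by N. Grouping
-- N steps at a time keeps this property, so the multiples of Q never return to z = 0. No associativity of
-- the group law is needed.
--
-- Rank zero: for p / q = 2 the curve is y² = ζ³ + ζ² − ζ, up to scaling and a shift. A rational point gives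
-- coprime solutions of m⁴ + m² n² − n⁴ = j², whence (2 m² + n²)² − (2 j)² = 5 n⁴, and splitting the left-hand side
-- into coprime factors twice leads to a solution with smaller m. Only six points remain, all torsion.
module Submission where

open import Defs
open import Data.Nat.Induction using (<-rec)
open import Data.Nat.GCD using (module Bézout)
open import Data.Nat.Coprimality as Coprimality using (Coprime; coprime-Bézout)
open import Data.List using (_∷_; [])
open import Data.Product
open import Data.Sum
open import Data.Empty
open import Function using (id)
open import Level using (0ℓ)
open import Relation.Binary.PropositionalEquality
open import Relation.Nullary
open import Relation.Nullary.Decidable using (dec⇒maybe; from-yes)
open import Tactic.RingSolver.Core.AlmostCommutativeRing using (AlmostCommutativeRing; fromCommutativeRing)

-- Descent on m⁴ + m² n² = j² + n⁴

module QuarticDescent where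
  open import Data.Nat
  open import Data.Nat.Properties
  open import Data.Nat.Divisibility
  open import Data.Nat.DivMod using (m/n*n≡m)
  open import Data.Nat.GCD using (gcd; gcd[m,n]∣m; gcd[m,n]∣n; gcd[m,n]≢0)
  open import Data.Nat.Coprimality as Coprimality using (Coprime; coprime-divisor; coprime-/gcd)
  open import Data.Nat.Primality using (Prime; euclidsLemma; prime[2]; prime?; prime⇒irreducible; prime⇒nonTrivial)
  open import Data.Nat.Primality.Factorisation using (factorise)
  open import Data.Nat.Tactic.RingSolver using (solve-∀)
  open import Data.Nat.Induction using (<-rec)
  open import Data.Nat.ListAction using (product)
  open import Data.List.Relation.Unary.All using (_∷_)
  open ≡-Reasoning

  sq-cancel-≤ : ∀ a b → a * a ≤ b * b → a ≤ b
  sq-cancel-≤ a b aa≤bb with a ≤? b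
  ... | yes a≤b = a≤b
  ... | no a≰b = contradiction aa≤bb (<⇒≱ (*-mono-< (≰⇒> a≰b) (≰⇒> a≰b)))

  sq-injective : ∀ a b → a * a ≡ b * b → a ≡ b
  sq-injective a b eq = ≤-antisym (sq-cancel-≤ a b (≤-reflexive eq)) (sq-cancel-≤ b a (≤-reflexive (sym eq)))

  prime∣sq : ∀ {p} a → Prime p → p ∣ a * a → p ∣ a
  prime∣sq a pp p∣aa = [ id , id ]′ (euclidsLemma a a pp p∣aa)

  prime∣fourth : ∀ {p} a → Prime p → p ∣ (a * a) * (a * a) → p ∣ a
  prime∣fourth a pp d = prime∣sq a pp (prime∣sq (a * a) pp d)

  prime∤1 : ∀ {p} → Prime p → ¬ (p ∣ 1)
  prime∤1 pp p∣1 with refl ← ∣1⇒≡1 p∣1 = contradiction (prime⇒nonTrivial pp) λ ()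

  prime-divisor : ∀ n → n ≢ 1 → ∃ λ p → Prime p × p ∣ n
  prime-divisor zero n≢1 = 2 , prime[2] , 2 ∣0
  prime-divisor n@(suc _) n≢1 with factorise n
  ... | record { factors = [] ; isFactorisation = eq } = contradiction eq n≢1
  ... | record { factors = p ∷ ps ; isFactorisation = eq ; factorsPrime = pp ∷ _ } =
    p , pp , divides (product ps) (trans eq (*-comm p (product ps)))

  coprime-by-primes : ∀ {a b} → (∀ {p} → Prime p → p ∣ a → p ∣ b → ⊥) → Coprime a b
  coprime-by-primes noPrime {d} (d∣a , d∣b) with d ≟ 1
  ... | yes d≡1 = d≡1
  ... | no d≢1 with prime-divisor d d≢1
  ...   | p , pp , p∣d = ⊥-elim (noPrime pp (∣-trans p∣d d∣a) (∣-trans p∣d d∣b))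

  coprime⇒no-prime : ∀ {a b p} → Coprime a b → Prime p → p ∣ a → p ∣ b → ⊥
  coprime⇒no-prime cop pp p∣a p∣b = prime∤1 pp (∣-reflexive (cop (p∣a , p∣b)))

  -- The square root of a is gcd a c.
  coprime-product-square : ∀ {a b} c → Coprime a b → a * b ≡ c * c → ∃ λ r → a ≡ r * r
  coprime-product-square {zero} c cop eq = 0 , refl
  coprime-product-square {a@(suc _)} {b} c cop eq = g , trans a≡a′g (cong (_* g) (∣-antisym a′∣g g∣a′))
    where
    g = gcd a c
    instance g≢0 : NonZero g
             g≢0 = ≢-nonZero (gcd[m,n]≢0 a c (inj₁ λ ()))
    a′ = a / g where open import Data.Nat.DivMod
    c′ = c / g where open import Data.Nat.DivMod
    open import Data.Nat.DivMod using (m/n*n≡m)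
    a≡a′g : a ≡ a′ * g
    a≡a′g = sym (m/n*n≡m (gcd[m,n]∣m a c))
    c≡c′g : c ≡ c′ * g
    c≡c′g = sym (m/n*n≡m (gcd[m,n]∣n a c))
    a′b≡gc′c′ : a′ * b ≡ g * (c′ * c′)
    a′b≡gc′c′ = *-cancelˡ-≡ _ _ g (begin
      g * (a′ * b)           ≡⟨ lemma₁ g a′ b ⟩
      (a′ * g) * b           ≡⟨ cong (_* b) (sym a≡a′g) ⟩
      a * b                  ≡⟨ eq ⟩
      c * c                  ≡⟨ cong₂ _*_ c≡c′g c≡c′g ⟩
      (c′ * g) * (c′ * g)    ≡⟨ lemma₂ g c′ ⟩
      g * (g * (c′ * c′))    ∎)
      where
      lemma₁ : ∀ g a b → g * (a * b) ≡ (a * g) * b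
      lemma₁ = solve-∀
      lemma₂ : ∀ g c → (c * g) * (c * g) ≡ g * (g * (c * c))
      lemma₂ = solve-∀
    a′⊥c′ : Coprime a′ c′
    a′⊥c′ = coprime-/gcd a c
    a′∣g : a′ ∣ g
    a′∣g = coprime-divisor a′⊥c′ (coprime-divisor a′⊥c′
      (divides b (trans (trans (lemma₃ g c′) (sym a′b≡gc′c′)) (*-comm a′ b))))
      where
      lemma₃ : ∀ g c → c * (c * g) ≡ g * (c * c)
      lemma₃ = solve-∀
    g⊥b : Coprime g b
    g⊥b (i∣g , i∣b) = cop (∣-trans i∣g (gcd[m,n]∣m a c) , i∣b)
    g∣a′ : g ∣ a′
    g∣a′ = coprime-divisor g⊥b (divides (c′ * c′) (trans (*-comm b a′) (trans a′b≡gc′c′ (*-comm g _))))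

  coprime-roots : ∀ {a b} → Coprime (a * a) (b * b) → Coprime a b
  coprime-roots {a} {b} cop (i∣a , i∣b) = cop (∣m⇒∣m*n a i∣a , ∣m⇒∣m*n b i∣b)

  coprime-product-squares : ∀ {a b} c → Coprime a b → a * b ≡ c * c →
    ∃₂ λ r s → a ≡ r * r × b ≡ s * s × r * s ≡ c × Coprime r s
  coprime-product-squares {a} {b} c cop eq
    with r , refl ← coprime-product-square c cop eq
    with s , refl ← coprime-product-square {b} {a} c (Coprimality.sym cop) (trans (*-comm b a) eq) =
    r , s , refl , refl , sq-injective (r * s) c (trans (lemma r s) eq) , coprime-roots cop
    where
    lemma : ∀ r s → (r * s) * (r * s) ≡ (r * r) * (s * s)
    lemma = solve-∀

  coprime-product-fourths : ∀ {a b} c → Coprime a b → a * b ≡ (c * c) * (c * c) →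
    ∃₂ λ r s → a ≡ (r * r) * (r * r) × b ≡ (s * s) * (s * s) × r * s ≡ c × Coprime r s
  coprime-product-fourths c cop eq
    with r , s , refl , refl , rs≡cc , r⊥s ← coprime-product-squares (c * c) cop eq
    with r′ , s′ , refl , refl , r′s′≡c , r′⊥s′ ← coprime-product-squares {r} {s} c r⊥s rs≡cc =
    r′ , s′ , refl , refl , r′s′≡c , r′⊥s′

  prime[5] : Prime 5
  prime[5] = from-yes (prime? 5)

  5*[a*b]≡a*5*b : ∀ a b → 5 * (a * b) ≡ a * 5 * b
  5*[a*b]≡a*5*b = solve-∀

  coprime-product-5fourths : ∀ {a b} c → Coprime a b → a * b ≡ 5 * ((c * c) * (c * c)) →
    ∃₂ λ r s → r * s ≡ c × Coprime r s ×
      a + b ≡ 5 * ((r * r) * (r * r)) + (s * s) * (s * s)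
  coprime-product-5fourths {a} {b} c cop eq with euclidsLemma a b prime[5] (divides ((c * c) * (c * c)) (trans eq (*-comm 5 ((c * c) * (c * c)))))
  ... | inj₁ (divides-refl a′)
    with r , s , refl , refl , rs≡c , r⊥s ← coprime-product-fourths {a′} {b} c
           (λ (i∣a , i∣b) → cop (∣m⇒∣m*n 5 i∣a , i∣b))
           (*-cancelˡ-≡ _ _ 5 (trans (5*[a*b]≡a*5*b a′ b) eq))
    = r , s , rs≡c
    , r⊥s
    , cong (_+ (s * s) * (s * s)) (*-comm ((r * r) * (r * r)) 5)
  ... | inj₂ (divides-refl b′)
    with s , r , refl , refl , sr≡c , s⊥r ← coprime-product-fourths {a} {b′} c
           (λ (i∣a , i∣b) → cop (i∣a , ∣m⇒∣m*n 5 i∣b))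
           (*-cancelˡ-≡ _ _ 5 (trans (trans (cong (5 *_) (*-comm a b′)) (trans (5*[a*b]≡a*5*b b′ a) (*-comm (b′ * 5) a))) eq))
    = r , s , trans (*-comm r s) sr≡c
    , Coprimality.sym s⊥r
    , trans (+-comm ((s * s) * (s * s)) ((r * r) * (r * r) * 5)) (cong (_+ (s * s) * (s * s)) (*-comm ((r * r) * (r * r)) 5))

  5x*5y : ∀ x y → x * 5 * (y * 5) ≡ 5 * (x * y * 5)
  5x*5y = solve-∀

  prime∣both⇒∣5fourth-root : ∀ {p a b} c → Prime p → p ∣ a → p ∣ b →
    a * b ≡ 5 * ((c * c) * (c * c)) → p ∣ c
  prime∣both⇒∣5fourth-root {p} c pp (divides-refl x) (divides-refl y) eq
    with euclidsLemma 5 _ pp (subst (p ∣_) eq (∣n⇒∣m*n (x * p) (n∣m*n y)))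
  ... | inj₂ p∣cccc = prime∣fourth c pp p∣cccc
  ... | inj₁ p∣5 with prime⇒irreducible prime[5] p∣5
  ...   | inj₁ refl = ⊥-elim (prime∤1 pp ∣-refl)
  ...   | inj₂ refl = prime∣fourth c pp (divides (x * y) (*-cancelˡ-≡ _ _ 5 (trans (sym eq) (5x*5y x y))))

  Quartic : ℕ → ℕ → ℕ → Set
  Quartic m n j = (m * m) * (m * m) + (m * m) * (n * n) ≡ j * j + (n * n) * (n * n)

  Trivial : ℕ → ℕ → Set
  Trivial m n = n ≡ 0 ⊎ (m ≡ 1 × n ≡ 1)

  TrivialBelow : ℕ → Set
  TrivialBelow m = ∀ m′ → m′ < m → ∀ n j → Coprime m′ n → Quartic m′ n j → Trivial m′ n

  odd-square-difference : ∀ a b → ∃ λ F →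
    (1 + 2 * (a + b)) * (1 + 2 * (a + b)) ≡ (1 + 2 * b) * (1 + 2 * b) + 4 * F
  odd-square-difference c b = c * c + 2 * (b * c) + c , lemma c b
    where
    lemma : ∀ c b → (1 + 2 * (c + b)) * (1 + 2 * (c + b)) ≡ (1 + 2 * b) * (1 + 2 * b) + 4 * (c * c + 2 * (b * c) + c)
    lemma = solve-∀

  odd-squares-distance : ∀ a b → let A = 1 + 2 * a; B = 1 + 2 * b in
    ∃ λ F → (A * A ≡ B * B + 4 * F) ⊎ (B * B ≡ A * A + 4 * F)
  odd-squares-distance a b with ≤-total b a
  ... | inj₁ b≤a with c , refl ← m≤n⇒∃[o]m+o≡n b≤a rewrite +-comm b c =
    let F , eq = odd-square-difference c b in F , inj₁ eq
  ... | inj₂ a≤b with c , refl ← m≤n⇒∃[o]m+o≡n a≤b rewrite +-comm a c =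
    let F , eq = odd-square-difference c a in F , inj₂ eq

  Odd : ℕ → Set
  Odd n = ∃ λ k → n ≡ 1 + 2 * k

  odd-distance : ∀ {A B} → Odd A → Odd B →
    ∃ λ F → (A * A ≡ B * B + 4 * F) ⊎ (B * B ≡ A * A + 4 * F)
  odd-distance (a , refl) (b , refl) = odd-squares-distance a b

  distance : ∀ x y → ∃ λ D → (x ≡ y + D) ⊎ (y ≡ x + D)
  distance x y with ≤-total y x
  ... | inj₁ y≤x = let D , eq = m≤n⇒∃[o]m+o≡n y≤x in D , inj₁ (sym eq)
  ... | inj₂ x≤y = let D , eq = m≤n⇒∃[o]m+o≡n x≤y in D , inj₂ (sym eq)

  -- 5P² − 2PQ + Q² = (P − Q)² + (2P)²
  complete-square : ∀ m P Q D → P ≡ Q + D ⊎ Q ≡ P + D →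
    m + 2 * (P * Q) ≡ 5 * (P * P) + Q * Q → m ≡ 4 * (P * P) + D * D
  complete-square m P Q D (inj₁ refl) eq = +-cancelʳ-≡ (2 * (P * Q)) _ _ (trans eq (lemma Q D))
    where
    lemma : ∀ Q D → 5 * ((Q + D) * (Q + D)) + Q * Q ≡ 4 * ((Q + D) * (Q + D)) + D * D + 2 * ((Q + D) * Q)
    lemma = solve-∀
  complete-square m P Q D (inj₂ refl) eq = +-cancelʳ-≡ (2 * (P * Q)) _ _ (trans eq (lemma P D))
    where
    lemma : ∀ P D → 5 * (P * P) + (P + D) * (P + D) ≡ 4 * (P * P) + D * D + 2 * (P * (P + D))
    lemma = solve-∀

  even-root : ∀ t x y → t * t + 2 * x ≡ 2 * y → ∃ λ e → t ≡ 2 * e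
  even-root t x y eq with prime∣sq t prime[2] (∣m+n∣m⇒∣n
      (subst (2 ∣_) (trans (sym eq) (+-comm (t * t) (2 * x))) (m∣m*n y)) (m∣m*n x))
  ... | divides e t≡e*2 = e , trans t≡e*2 (*-comm e 2)

  square-of-sum : ∀ D t → D * D + (t * t + 2 * (D * t)) ≡ (D + t) * (D + t)
  square-of-sum = solve-∀

  square-of-sum₂ : ∀ D e → D * D + 4 * (e * (e + D)) ≡ (D + 2 * e) * (D + 2 * e)
  square-of-sum₂ = solve-∀

  square-gap : ∀ m D E → m * m ≡ D * D + 4 * E → ∃ λ e → m ≡ D + 2 * e × e * (e + D) ≡ E
  square-gap m D E eq
    with t , refl ← m≤n⇒∃[o]m+o≡n (sq-cancel-≤ D m (≤-trans (m≤m+n (D * D) (4 * E)) (≤-reflexive (sym eq))))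
    with e , refl ← even-root t (D * t) (2 * E)
           (+-cancelˡ-≡ (D * D) _ _ (trans (square-of-sum D t) (trans eq (cong (D * D +_) (*-assoc 2 2 E)))))
    = e , refl , *-cancelˡ-≡ _ _ 4 (+-cancelˡ-≡ (D * D) _ _ (trans (square-of-sum₂ D e) eq))

  quartic-from-gap : ∀ g h B D → h * h * (h * h) ≡ D + g * g * (g * g) →
    (g * h) * (g * h) ≡ B * B + D ⊎ B * B ≡ (g * h) * (g * h) + D →
    Quartic g h B ⊎ Quartic h g B
  quartic-from-gap g h B D gap (inj₁ eq) = inj₁ (begin
    (g * g) * (g * g) + (g * g) * (h * h)  ≡⟨ lemma₁ g h ⟩
    (g * h) * (g * h) + g * g * (g * g)    ≡⟨ cong (_+ g * g * (g * g)) eq ⟩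
    B * B + D + g * g * (g * g)            ≡⟨ +-assoc (B * B) D _ ⟩
    B * B + (D + g * g * (g * g))          ≡⟨ cong (B * B +_) (sym gap) ⟩
    B * B + h * h * (h * h)                ∎)
    where
    open ≡-Reasoning
    lemma₁ : ∀ g h → (g * g) * (g * g) + (g * g) * (h * h) ≡ (g * h) * (g * h) + g * g * (g * g)
    lemma₁ = solve-∀
  quartic-from-gap g h B D gap (inj₂ eq) = inj₂ (begin
    (h * h) * (h * h) + (h * h) * (g * g)       ≡⟨ cong (_+ (h * h) * (g * g)) gap ⟩
    D + g * g * (g * g) + (h * h) * (g * g)     ≡⟨ lemma₁ g h D ⟩
    (g * h) * (g * h) + D + g * g * (g * g)     ≡⟨ cong (_+ g * g * (g * g)) (sym eq) ⟩
    B * B + (g * g) * (g * g)                   ∎)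
    where
    open ≡-Reasoning
    lemma₁ : ∀ g h D → D + g * g * (g * g) + (h * h) * (g * g) ≡ (g * h) * (g * h) + D + g * g * (g * g)
    lemma₁ = solve-∀

  descend : ∀ {m} g h B D → TrivialBelow m → Coprime g h → g ≢ 0 → h ≢ 0 → g < m → h < m →
    h * h * (h * h) ≡ D + g * g * (g * g) →
    (g * h) * (g * h) ≡ B * B + D ⊎ B * B ≡ (g * h) * (g * h) + D → g ≡ 1 × h ≡ 1
  descend g h B D ih g⊥h g≢0 h≢0 g<m h<m gap eq with quartic-from-gap g h B D gap eq
  ... | inj₁ q with ih g g<m h B g⊥h q
  ...   | inj₁ h≡0 = contradiction h≡0 h≢0
  ...   | inj₂ r = r
  descend g h B D ih g⊥h g≢0 h≢0 g<m h<m gap eq | inj₂ q with ih h h<m g B (Coprimality.sym g⊥h) q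
  ...   | inj₁ g≡0 = contradiction g≡0 g≢0
  ...   | inj₂ (h≡1 , g≡1) = g≡1 , h≡1

  n≤n*n : ∀ n → n ≤ n * n
  n≤n*n zero = z≤n
  n≤n*n n@(suc _) = m≤m*n n n

  *≢0ˡ : ∀ {a b} → a * b ≢ 0 → a ≢ 0
  *≢0ˡ ab≢0 refl = ab≢0 refl

  *≢0ʳ : ∀ a {b} → a * b ≢ 0 → b ≢ 0
  *≢0ʳ a ab≢0 refl = ab≢0 (*-zeroʳ a)

  <fourths : ∀ g h → g ≢ 0 → h ≢ 0 → g < (g * g) * (g * g) + (h * h) * (h * h) × h < (g * g) * (g * g) + (h * h) * (h * h)
  <fourths g h g≢0 h≢0 =
    <-≤-trans (m<m+n g (n≢0⇒n>0 h≢0)) (+-mono-≤ (≤fourth g) (≤fourth h)) ,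
    <-≤-trans (m<n+m h (n≢0⇒n>0 g≢0)) (+-mono-≤ (≤fourth g) (≤fourth h))
    where
    ≤fourth : ∀ n → n ≤ (n * n) * (n * n)
    ≤fourth n = ≤-trans (n≤n*n n) (n≤n*n (n * n))

  even-completion : ∀ m N → (m * m + 2 * (N * N)) * (m * m + 2 * (N * N)) ≡
    (m * m) * (m * m) + (m * m) * ((2 * N) * (2 * N)) + 4 * ((N * N) * (N * N))
  even-completion = solve-∀

  even-completion′ : ∀ j N → j * j + ((2 * N) * (2 * N)) * ((2 * N) * (2 * N)) + 4 * ((N * N) * (N * N)) ≡
    j * j + 4 * (5 * ((N * N) * (N * N)))
  even-completion′ = solve-∀

  square-of-product : ∀ A B → (A * A) * (B * B) ≡ (A * B) * (A * B)
  square-of-product = solve-∀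

  d+[d+j] : ∀ d j → d + (d + j) ≡ j + 2 * d
  d+[d+j] = solve-∀

  even-step : ∀ m N j → TrivialBelow m → Coprime m (2 * N) → Quartic m (2 * N) j → N ≡ 0
  even-step m N j ih m⊥n q with N ≟ 0
  ... | yes N≡0 = N≡0
  ... | no N≢0
    with d , u≡j+2d , dd′ ← square-gap (m * m + 2 * (N * N)) j (5 * ((N * N) * (N * N)))
           (trans (even-completion m N) (trans (cong (_+ 4 * ((N * N) * (N * N))) q) (even-completion′ j N)))
    with A , B , refl , A⊥B , sum ← coprime-product-5fourths N (coprime-by-primes {d} {d + j} λ {p} pp p∣d p∣d+j →
           let p∣N = prime∣both⇒∣5fourth-root N pp p∣d p∣d+j dd′
               p∣u = subst (p ∣_) (trans (d+[d+j] d j) (sym u≡j+2d)) (∣m∣n⇒∣m+n p∣d p∣d+j)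
               p∣mm = ∣m+n∣m⇒∣n (subst (p ∣_) (+-comm (m * m) _) p∣u) (∣n⇒∣m*n 2 (∣m⇒∣m*n N p∣N))
           in coprime⇒no-prime m⊥n pp (prime∣sq m pp p∣mm) (∣n⇒∣m*n 2 p∣N)) dd′
    with D , dist ← distance (A * A) (B * B)
    with e , m≡D+2e , ee′ ← square-gap m D ((A * A) * (A * A)) (trans (complete-square (m * m) (A * A) (B * B) D dist
           (trans (cong (λ x → m * m + 2 * x) (square-of-product A B)) (trans u≡j+2d (trans (sym (d+[d+j] d j)) sum)))) (+-comm _ (D * D)))
    with g , h , refl , e+D≡h⁴ , refl , g⊥h ← coprime-product-fourths A (coprime-by-primes {e} {e + D} λ {p} pp p∣e p∣e+D →
           let p∣A = prime∣fourth A pp (subst (p ∣_) ee′ (∣m⇒∣m*n (e + D) p∣e))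
               p∣D = ∣m+n∣m⇒∣n p∣e+D p∣e
           in coprime⇒no-prime A⊥B pp p∣A (prime∣sq B pp ([ (λ P≡Q+D → ∣m+n∣m⇒∣n (subst (p ∣_) (trans P≡Q+D (+-comm (B * B) D)) (∣m⇒∣m*n A p∣A)) p∣D)
                                                        , (λ Q≡P+D → subst (p ∣_) (sym Q≡P+D) (∣m∣n⇒∣m+n (∣m⇒∣m*n A p∣A) p∣D)) ]′ dist))) ee′
    = contradiction (m⊥n (2∣m , m∣m*n N)) λ ()
    where
    gh≢0 : g * h ≢ 0
    gh≢0 = *≢0ˡ {_} {B} N≢0
    g≢0 = *≢0ˡ {g} {h} gh≢0
    h≢0 = *≢0ʳ g gh≢0
    m≡ : m ≡ e + (h * h) * (h * h)
    m≡ = trans m≡D+2e (trans (sym (d+[d+j] e D)) (cong (e +_) e+D≡h⁴))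
    bounds = <fourths g h g≢0 h≢0
    g≡h≡1 : g ≡ 1 × h ≡ 1
    g≡h≡1 = descend g h B D ih
      g⊥h g≢0 h≢0 (subst (g <_) (sym m≡) (proj₁ bounds)) (subst (h <_) (sym m≡) (proj₂ bounds))
      (trans (sym e+D≡h⁴) (+-comm e D)) dist
    2∣m : 2 ∣ m
    2∣m with refl , refl ← g≡h≡1 with refl ← +-cancelˡ-≡ 1 D 0 e+D≡h⁴ = subst (2 ∣_) (sym m≡D+2e) ∣-refl

  even-or-odd : ∀ n → ∃ λ k → n ≡ 2 * k ⊎ n ≡ 1 + 2 * k
  even-or-odd zero = 0 , inj₁ refl
  even-or-odd (suc n) with even-or-odd n
  ... | k , inj₁ refl = k , inj₂ refl
  ... | k , inj₂ refl = suc k , inj₁ (cong suc (sym (+-suc k (k + 0))))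

  odd≢even : ∀ k l → 1 + 2 * k ≢ 2 * l
  odd≢even k l eq with () ← ∣1⇒≡1 (∣m+n∣m⇒∣n (subst (2 ∣_) (+-comm 1 (2 * k)) (subst (2 ∣_) (sym eq) (m∣m*n l))) (m∣m*n k))

  odd-factor : ∀ A B k → A * B ≡ 1 + 2 * k → Odd A
  odd-factor A B k eq with even-or-odd A
  ... | a , inj₂ A≡ = a , A≡
  ... | a , inj₁ refl = contradiction (trans (sym eq) (*-assoc 2 a B)) (odd≢even k (a * B))

  odd-completion : ∀ m n → (2 * (m * m) + n * n) * (2 * (m * m) + n * n) ≡
    4 * ((m * m) * (m * m) + (m * m) * (n * n)) + (n * n) * (n * n)
  odd-completion = solve-∀

  odd-completion′ : ∀ j n → 4 * (j * j + (n * n) * (n * n)) + (n * n) * (n * n) ≡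
    (2 * j) * (2 * j) + 5 * ((n * n) * (n * n))
  odd-completion′ = solve-∀

  square-of-sum₃ : ∀ j d → (2 * j) * (2 * j) + d * (d + 4 * j) ≡ (2 * j + d) * (2 * j + d)
  square-of-sum₃ = solve-∀

  d+[d+4j] : ∀ d j → d + (d + 4 * j) ≡ 2 * (2 * j + d)
  d+[d+4j] = solve-∀

  quadruple : ∀ m n → 2 * (2 * m + n) ≡ 4 * m + 2 * n
  quadruple = solve-∀

  halve-twice : ∀ P F → 4 * (P * P) + (4 * F) * (4 * F) ≡ 4 * (P * P + 4 * (F * F))
  halve-twice = solve-∀

  square-of-sum₄ : ∀ s k → s * s + k * (k + 2 * s) ≡ (s + k) * (s + k)
  square-of-sum₄ = solve-∀

  fourth-gap : ∀ s h → (h * h + 2 * s) * (h * h + 2 * s) ≡ 4 * (s * (s + h * h)) + h * h * (h * h)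
  fourth-gap = solve-∀

  prime∣4⇒2 : ∀ {p} → Prime p → p ∣ 4 → p ≡ 2
  prime∣4⇒2 pp p∣4 with prime⇒irreducible prime[2] (prime∣sq 2 pp p∣4)
  ... | inj₁ refl = ⊥-elim (prime∤1 pp ∣-refl)
  ... | inj₂ p≡2 = p≡2

  odd-factors : ∀ m n k j → n ≡ 1 + 2 * k → Coprime m n → Quartic m n j →
    ∃₂ λ A B → A * B ≡ n × Coprime A B ×
      4 * (m * m) + 2 * ((A * A) * (B * B)) ≡ 5 * ((A * A) * (A * A)) + (B * B) * (B * B)
  odd-factors m n k j n-odd m⊥n q = A , B , AB≡n , A⊥B ,
      trans (cong (λ x → 4 * (m * m) + 2 * x) (trans (square-of-product A B) (cong (λ x → x * x) AB≡n))) (trans (sym d+d′) sum)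
    where
    sq≡ : (2 * (m * m) + n * n) * (2 * (m * m) + n * n) ≡ (2 * j) * (2 * j) + 5 * ((n * n) * (n * n))
    sq≡ = trans (odd-completion m n) (trans (cong (λ x → 4 * x + (n * n) * (n * n)) q) (odd-completion′ j n))
    gap = m≤n⇒∃[o]m+o≡n (sq-cancel-≤ (2 * j) (2 * (m * m) + n * n)
           (≤-trans (m≤m+n ((2 * j) * (2 * j)) _) (≤-reflexive (sym sq≡))))
    d = proj₁ gap
    dd′ : d * (d + 4 * j) ≡ 5 * ((n * n) * (n * n))
    dd′ = +-cancelˡ-≡ ((2 * j) * (2 * j)) _ _
           (trans (square-of-sum₃ j d) (trans (cong₂ _*_ (proj₂ gap) (proj₂ gap)) sq≡))
    d+d′ : d + (d + 4 * j) ≡ 4 * (m * m) + 2 * (n * n)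
    d+d′ = trans (d+[d+4j] d j) (trans (cong (2 *_) (proj₂ gap)) (quadruple (m * m) (n * n)))
    d⊥d′ : Coprime d (d + 4 * j)
    d⊥d′ = coprime-by-primes λ {p} pp p∣d p∣d′ →
      let p∣n = prime∣both⇒∣5fourth-root n pp p∣d p∣d′ dd′
          p∣4mm = ∣m+n∣m⇒∣n (subst (p ∣_) (trans d+d′ (+-comm (4 * (m * m)) _)) (∣m∣n⇒∣m+n p∣d p∣d′)) (∣n⇒∣m*n 2 (∣m⇒∣m*n n p∣n))
      in [ (λ p∣4 → 2∤n (subst (_∣ n) (prime∣4⇒2 pp p∣4) p∣n))
         , (λ p∣mm → coprime⇒no-prime m⊥n pp (prime∣sq m pp p∣mm) p∣n) ]′ (euclidsLemma 4 (m * m) pp p∣4mm)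
      where
      2∤n : ¬ (2 ∣ n)
      2∤n (divides l n≡l*2) = odd≢even k l (trans (sym n-odd) (trans n≡l*2 (*-comm l 2)))
    factors = coprime-product-5fourths n d⊥d′ dd′
    A = proj₁ factors
    B = proj₁ (proj₂ factors)
    AB≡n = proj₁ (proj₂ (proj₂ factors))
    A⊥B = proj₁ (proj₂ (proj₂ (proj₂ factors)))
    sum = proj₂ (proj₂ (proj₂ (proj₂ factors)))

  odd-step : ∀ m A B a F → A ≡ 1 + 2 * a → A * A ≡ B * B + 4 * F ⊎ B * B ≡ A * A + 4 * F →
    TrivialBelow m → Coprime m (A * B) → Coprime A B →
    4 * (m * m) + 2 * ((A * A) * (B * B)) ≡ 5 * ((A * A) * (A * A)) + (B * B) * (B * B) → m ≡ 1 × A * B ≡ 1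
  odd-step m A B a F A-odd dist ih m⊥AB A⊥B eq
    with e , m≡P+2e , ee′ ← square-gap m (A * A) (F * F) (*-cancelˡ-≡ _ _ 4
           (trans (complete-square (4 * (m * m)) (A * A) (B * B) (4 * F) dist eq) (halve-twice (A * A) F)))
    with s , r , refl , e′≡rr , refl , s⊥r ← coprime-product-squares F (coprime-by-primes {e} {e + A * A} λ {p} pp p∣e p∣e′ →
           let p∣P = ∣m+n∣m⇒∣n p∣e′ p∣e
           in coprime⇒no-prime m⊥AB pp (subst (p ∣_) (sym m≡P+2e) (∣m∣n⇒∣m+n p∣P (∣n⇒∣m*n 2 p∣e))) (∣m⇒∣m*n B (prime∣sq A pp p∣P))) ee′
    with k , refl ← m≤n⇒∃[o]m+o≡n (sq-cancel-≤ s r (≤-trans (m≤m+n (s * s) (A * A)) (≤-reflexive e′≡rr)))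
    with kk′ ← +-cancelˡ-≡ (s * s) (k * (k + 2 * s)) (A * A) (trans (square-of-sum₄ s k) (sym e′≡rr))
    with h , g , refl , k′≡gg , refl , h⊥g ← coprime-product-squares A (coprime-by-primes {k} {k + 2 * s} λ {p} pp p∣k p∣k′ →
           let p∣A = prime∣sq A pp (subst (p ∣_) kk′ (∣m⇒∣m*n (k + 2 * s) p∣k))
           in [ (λ p∣2 → prime∤1 pp (∣m+n∣m⇒∣n (subst (p ∣_) (trans A-odd (+-comm 1 (2 * a))) p∣A) (∣m⇒∣m*n a p∣2)))
              , (λ p∣s → coprime⇒no-prime s⊥r pp p∣s (∣m∣n⇒∣m+n p∣s p∣k)) ]′ (euclidsLemma 2 s pp (∣m+n∣m⇒∣n p∣k′ p∣k))) kk′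
    with s ≟ 0
  ... | yes refl = trans m≡P+2e (trans (+-identityʳ (h * g * (h * g))) (cong (λ x → x * x) hg≡1)) , cong₂ _*_ hg≡1 (trans (sym A≡B) hg≡1)
    where
    A≡B : h * g ≡ B
    A≡B = sq-injective (h * g) B ([ (λ eq → trans eq (+-identityʳ _)) , (λ eq → sym (trans eq (+-identityʳ _))) ]′ dist)
    hg≡1 : h * g ≡ 1
    hg≡1 = A⊥B (∣-refl , ∣-reflexive A≡B)
  ... | no s≢0 = contradiction (trans (cong (λ h → h * h + 2 * s) (sym (proj₁ h≡g≡1))) (trans k′≡gg (cong (λ g → g * g) (proj₂ h≡g≡1)))) λ eq → s≢0 (m*n≡0⇒m≡0 s 2 (trans (*-comm s 2) (+-cancelˡ-≡ 1 (2 * s) 0 eq)))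
    where
    hg≢0 : h * g ≢ 0
    hg≢0 eq = contradiction (trans (sym A-odd) eq) λ ()
    h≢0 = *≢0ˡ {h} {g} hg≢0
    g≢0 = *≢0ʳ h hg≢0
    m≡ : m ≡ s * s + r * r
    m≡ = trans m≡P+2e (trans (sym (d+[d+j] (s * s) _)) (cong (s * s +_) e′≡rr))
    1<r : 1 < r
    1<r = +-mono-≤ (n≢0⇒n>0 s≢0) (≤-trans (n≢0⇒n>0 h≢0) (n≤n*n h))
    r<rr : r < r * r
    r<rr = m<m*n r r {{>-nonZero (<-trans z<s 1<r)}} 1<r
    gg<m : g * g < m
    gg<m = subst₂ _<_ (trans (lemma s (h * h)) k′≡gg) (sym m≡) (+-mono-≤-< (n≤n*n s) r<rr)
      where
      lemma : ∀ s k → s + (s + k) ≡ k + 2 * s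
      lemma = solve-∀
    h<m : h < m
    h<m = <-≤-trans (≤-<-trans (≤-trans (n≤n*n h) (m≤n+m (h * h) s)) r<rr) (≤-trans (m≤n+m (r * r) (s * s)) (≤-reflexive (sym m≡)))
    h≡g≡1 : h ≡ 1 × g ≡ 1
    h≡g≡1 = descend h g B (4 * (s * r)) ih h⊥g h≢0 g≢0 h<m (≤-<-trans (n≤n*n g) gg<m)
      (trans (cong (λ x → x * x) (sym k′≡gg)) (fourth-gap s h)) dist

  quartic-odd : ∀ {m n} → TrivialBelow m → Odd n → Coprime m n →
    (∃₂ λ A B → A * B ≡ n × Coprime A B ×
      4 * (m * m) + 2 * ((A * A) * (B * B)) ≡ 5 * ((A * A) * (A * A)) + (B * B) * (B * B)) → m ≡ 1 × n ≡ 1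
  quartic-odd {m} ih (k , n-odd) m⊥n (A , B , refl , A⊥B , eq)
    with a , A-odd ← odd-factor A B k n-odd
    with b , B-odd ← odd-factor B A k (trans (*-comm B A) n-odd)
    with F , dist ← odd-distance (a , A-odd) (b , B-odd)
    = odd-step m A B a F A-odd dist ih m⊥n A⊥B eq

  quartic-trivial-step : ∀ m → TrivialBelow m → ∀ n j → Coprime m n → Quartic m n j → Trivial m n
  quartic-trivial-step m ih n j m⊥n q with even-or-odd n
  ... | N , inj₁ refl = inj₁ (cong (2 *_) (even-step m N j ih m⊥n q))
  ... | k , inj₂ n-odd = inj₂ (quartic-odd ih (k , n-odd) m⊥n (odd-factors m n k j n-odd m⊥n q))

  opaque
    quartic-trivial : ∀ m n j → Coprime m n → Quartic m n j → Trivial m n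
    quartic-trivial = <-rec (λ m → ∀ n j → Coprime m n → Quartic m n j → Trivial m n)
      λ m rec → quartic-trivial-step m λ m′ m′<m → rec m′<m

  opaque
    sq-∣-sq′ : ∀ a b g k .{{_ : NonZero g}} → Coprime a b → (b * g) * (b * g) ≡ k * ((a * g) * (a * g)) →
      a * g ∣ b * g
    sq-∣-sq′ a b g k a⊥b eq = divides b (trans (cong (b *_) (sym (*-identityˡ g))) (cong (λ a → b * (a * g)) (sym a≡1)))
      where
      lemma₁ : ∀ b g → b * b * g * g ≡ (b * g) * (b * g)
      lemma₁ = solve-∀
      lemma₂ : ∀ k a g → k * ((a * g) * (a * g)) ≡ k * a * a * g * g
      lemma₂ = solve-∀
      bb≡kaa : b * b ≡ k * a * a
      bb≡kaa = *-cancelʳ-≡ (b * b) (k * a * a) g (*-cancelʳ-≡ (b * b * g) (k * a * a * g) g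
        (trans (lemma₁ b g) (trans eq (lemma₂ k a g))))
      a≡1 : a ≡ 1
      a≡1 = a⊥b (∣-refl , coprime-divisor a⊥b (divides (k * a) bb≡kaa))

    sq-∣-sq : ∀ a b → a ≢ 0 → a * a ∣ b * b → a ∣ b
    sq-∣-sq a b a≢0 (divides k bb≡kaa) = subst₂ _∣_ a≡ b≡ (sq-∣-sq′ (a / g) (b / g) g k (coprime-/gcd a b)
        (trans (cong₂ _*_ b≡ b≡) (trans bb≡kaa (cong (λ a → k * (a * a)) (sym a≡)))))
      where
      g : ℕ
      g = gcd a b
      instance g≢0 : NonZero g
               g≢0 = ≢-nonZero (gcd[m,n]≢0 a b (inj₁ a≢0))
      a≡ : (a / g) * g ≡ a
      a≡ = m/n*n≡m (gcd[m,n]∣m a b)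
      b≡ : (b / g) * g ≡ b
      b≡ = m/n*n≡m (gcd[m,n]∣n a b)

    square-factors : ∀ m N r T J → T ≢ 0 → Coprime m N → Coprime m J → Coprime N J →
      r * r * (N * N * N) ≡ T * T * (m * J) →
      (∃ λ i → m ≡ i * i) × (∃ λ i → N ≡ i * i) × (∃ λ i → J ≡ i * i)
    square-factors m N r T J T≢0 m⊥N m⊥J N⊥J eq =
      let N-square , mJ-square = both (sq-∣-sq T (r * (N * N)) T≢0 (divides (N * (m * J)) rNN²≡))
          m-square , J-square = split mJ-square
      in m-square , N-square , J-square
      where
      lemma₁ : ∀ r N → (r * (N * N)) * (r * (N * N)) ≡ N * (r * r * (N * N * N))
      lemma₁ = solve-∀
      lemma₂ : ∀ N T x → N * (T * T * x) ≡ N * x * (T * T)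
      lemma₂ = solve-∀
      lemma₃ : ∀ k T → (k * T) * (k * T) ≡ k * k * (T * T)
      lemma₃ = solve-∀
      rNN²≡ : (r * (N * N)) * (r * (N * N)) ≡ N * (m * J) * (T * T)
      rNN²≡ = trans (lemma₁ r N) (trans (cong (N *_) eq) (lemma₂ N T (m * J)))
      instance TT≢0 : NonZero (T * T)
               TT≢0 = m*n≢0 T T {{≢-nonZero T≢0}} {{≢-nonZero T≢0}}
      N⊥mJ : Coprime N (m * J)
      N⊥mJ = coprime-by-primes λ {p} pp p∣N p∣mJ →
        [ (λ p∣m → coprime⇒no-prime m⊥N pp p∣m p∣N) , (λ p∣J → coprime⇒no-prime N⊥J pp p∣N p∣J) ]′ (euclidsLemma m J pp p∣mJ)
      both : T ∣ r * (N * N) → (∃ λ i → N ≡ i * i) × (∃ λ i → m * J ≡ i * i)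
      both (divides k rNN≡kT) =
        let i , l , N≡ii , mJ≡ll , _ = coprime-product-squares {N} {m * J} k N⊥mJ
              (*-cancelʳ-≡ (N * (m * J)) (k * k) (T * T) (trans (sym rNN²≡) (trans (cong₂ _*_ rNN≡kT rNN≡kT) (lemma₃ k T))))
        in (i , N≡ii) , (l , mJ≡ll)
      split : (∃ λ i → m * J ≡ i * i) → (∃ λ i → m ≡ i * i) × (∃ λ i → J ≡ i * i)
      split (k , mJ≡kk) =
        let i , l , m≡ii , J≡ll , _ = coprime-product-squares {m} {J} k m⊥J mJ≡kk
        in (i , m≡ii) , (l , J≡ll)

    -- J = Q − P, kept on the left so that no subtraction occurs.
    take-difference : ∀ m N r T P Q → T ≢ 0 → m ≢ 0 →
      r * r * (N * N * N) + T * T * (m * P) ≡ T * T * (m * Q) →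
      ∃ λ J → J + P ≡ Q × r * r * (N * N * N) ≡ T * T * (m * J)
    take-difference m N r T P Q T≢0 m≢0 eq =
      let J , P+J≡Q = m≤n⇒∃[o]m+o≡n P≤Q
          J+P≡Q = trans (+-comm J P) P+J≡Q
      in J , J+P≡Q , +-cancelʳ-≡ (T * T * (m * P)) (r * r * (N * N * N)) (T * T * (m * J))
           (trans eq (trans (cong (λ Q → T * T * (m * Q)) (sym J+P≡Q)) (lemma (T * T) m J P)))
      where
      lemma : ∀ T m J P → T * (m * (J + P)) ≡ T * (m * J) + T * (m * P)
      lemma = solve-∀
      instance
        T-nonZero : NonZero T
        T-nonZero = ≢-nonZero T≢0
        m-nonZero : NonZero m
        m-nonZero = ≢-nonZero m≢0
        TT-nonZero : NonZero (T * T)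
        TT-nonZero = m*n≢0 T T
      TTmP≤TTmQ : T * T * (m * P) ≤ T * T * (m * Q)
      TTmP≤TTmQ = subst (T * T * (m * P) ≤_) eq (m≤n+m (T * T * (m * P)) (r * r * (N * N * N)))
      P≤Q : P ≤ Q
      P≤Q = *-cancelˡ-≤ {P} {Q} m (*-cancelˡ-≤ {m * P} {m * Q} (T * T) TTmP≤TTmQ)

    coprime-to-difference : ∀ X Z J → Coprime X Z → J + X * X ≡ Z * Z + X * Z → Coprime X J × Coprime Z J
    coprime-to-difference X Z J X⊥Z eq =
      coprime-by-primes (λ {p} pp p∣X p∣J → coprime⇒no-prime X⊥Z pp p∣X (prime∣sq Z pp
        (∣m+n∣m⇒∣n (subst (p ∣_) (trans eq (+-comm (Z * Z) (X * Z))) (∣m∣n⇒∣m+n p∣J (∣m⇒∣m*n X p∣X))) (∣m⇒∣m*n Z p∣X)))) ,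
      coprime-by-primes (λ {p} pp p∣Z p∣J → coprime⇒no-prime X⊥Z pp (prime∣sq X pp
        (∣m+n∣m⇒∣n (subst (p ∣_) (sym eq) (∣m∣n⇒∣m+n (∣m⇒∣m*n Z p∣Z) (∣n⇒∣m*n X p∣Z))) p∣J)) p∣Z)

  positive-point : ∀ m N r T → T ≢ 0 → m ≢ 0 → N ≢ 0 → Coprime m N →
    r * r * (N * N * N) + T * T * (m * (N * N)) ≡ T * T * (m * (m * m + N * m)) → m ≡ 1 × N ≡ 1
  positive-point m N r T T≢0 m≢0 N≢0 m⊥N eq
    with J , J+NN , eq′ ← take-difference m N r T (N * N) (m * m + N * m) T≢0 m≢0 eq
    with N⊥J , m⊥J ← coprime-to-difference N m J (Coprimality.sym m⊥N) J+NN
    with (i , refl) , (k , refl) , (j , refl) ← square-factors m N r T J T≢0 m⊥N m⊥J N⊥J eq′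
    with quartic-trivial i k j (λ (d∣i , d∣k) → m⊥N (∣m⇒∣m*n i d∣i , ∣m⇒∣m*n k d∣k))
           (trans (cong (i * i * (i * i) +_) (*-comm (i * i) (k * k))) (sym J+NN))
  ... | inj₁ refl = contradiction refl N≢0
  ... | inj₂ (refl , refl) = refl , refl

  negative-point : ∀ m N r T → T ≢ 0 → m ≢ 0 → N ≢ 0 → Coprime m N →
    r * r * (N * N * N) + T * T * (m * (m * m)) ≡ T * T * (m * (N * N + m * N)) → m ≡ 1 × N ≡ 1
  negative-point m N r T T≢0 m≢0 N≢0 m⊥N eq
    with J , J+mm , eq′ ← take-difference m N r T (m * m) (N * N + m * N) T≢0 m≢0 eq
    with m⊥J , N⊥J ← coprime-to-difference m N J m⊥N J+mm
    with (i , refl) , (k , refl) , (j , refl) ← square-factors m N r T J T≢0 m⊥N m⊥J N⊥J eq′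
    with quartic-trivial k i j (λ (d∣k , d∣i) → m⊥N (∣m⇒∣m*n i d∣i , ∣m⇒∣m*n k d∣k))
           (trans (cong (k * k * (k * k) +_) (*-comm (k * k) (i * i))) (sym J+mm))
  ... | inj₁ refl = contradiction refl m≢0
  ... | inj₂ (refl , refl) = refl , refl

open import Data.Nat as ℕ using (ℕ; zero; suc)
import Data.Nat.Properties as ℕ
import Data.Nat.Divisibility as ℕ
open import Data.Integer as ℤ using (ℤ; +_; -[1+_]; +[1+_])
import Data.Integer.Properties as ℤ
import Data.Integer.Divisibility.Signed as ℤˢ
open import Data.Rational
open import Data.Rational.Properties
import Data.Rational.Unnormalised as ℚᵘ
open import Tactic.RingSolver using (solve-∀)

open QuarticDescent using (even-or-odd; positive-point; negative-point)

-- Arithmetic in ℚ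

ℚ-ring : AlmostCommutativeRing 0ℓ 0ℓ
ℚ-ring = fromCommutativeRing +-*-commutativeRing λ x → dec⇒maybe (0ℚ ≟ x)

opaque
  ι : ℤ → ℚ
  ι i = i / 1

  ι≡mkℚ : ∀ i → ι i ≡ mkℚ i 0 (Coprimality.sym (Coprimality.1-coprimeTo ℤ.∣ i ∣))
  ι≡mkℚ i = ↥p/↧p≡p (mkℚ i 0 (Coprimality.sym (Coprimality.1-coprimeTo ℤ.∣ i ∣)))

  ι-ℕ : ∀ n → ι (+ n) ≡ ℚ[ n ]
  ι-ℕ n = refl

  ι-+ : ∀ i j → ι (i ℤ.+ j) ≡ ι i + ι j
  ι-+ i j rewrite ι≡mkℚ i | ι≡mkℚ j = cong (_/ 1) (cong₂ ℤ._+_ (sym (ℤ.*-identityʳ i)) (sym (ℤ.*-identityʳ j)))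

  ι-* : ∀ i j → ι (i ℤ.* j) ≡ ι i * ι j
  ι-* i j rewrite ι≡mkℚ i | ι≡mkℚ j = refl

  ι-neg : ∀ i → ι (ℤ.- i) ≡ - ι i
  ι-neg i rewrite ι≡mkℚ i | ι≡mkℚ (ℤ.- i) with i
  ... | + zero = refl
  ... | +[1+ n ] = refl
  ... | -[1+ n ] = refl

  ι-injective : ∀ {i j} → ι i ≡ ι j → i ≡ j
  ι-injective {i} {j} eq rewrite ι≡mkℚ i | ι≡mkℚ j = cong ↥_ eq

  p*↧p≡↥p : ∀ p → p * ι (↧ p) ≡ ι (↥ p)
  p*↧p≡↥p p@(mkℚ n d _) rewrite ι≡mkℚ (+ suc d) =
    fromℚᵘ-cong {ℚᵘ.mkℚᵘ (n ℤ.* + suc d) (d ℕ.* 1)} {ℚᵘ.mkℚᵘ n 0}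
      (ℚᵘ.*≡* (trans (ℤ.*-assoc n (+ suc d) (+ 1)) (cong (n ℤ.*_) (sym (ℤ.pos-* (suc d) 1)))))

ι-suc : ∀ n → ι (+ suc n) ≡ 1ℚ + ι (+ n)
ι-suc n = trans (ι-+ (+ 1) (+ n)) (cong (λ x → x + ι (+ n)) (ι-ℕ 1))

opaque
  inverse : ∀ p → p ≢ 0ℚ → ∃ λ q → p * q ≡ 1ℚ
  inverse p p≢0 = (1/ p) {{≢-nonZero p≢0}} , *-inverseʳ p {{≢-nonZero p≢0}}

  x-y≡0⇒x≡y : ∀ {x y} → x - y ≡ 0ℚ → x ≡ y
  x-y≡0⇒x≡y {x} {y} eq = trans (lemma x y) (trans (cong (_+ y) eq) (+-identityˡ y))
    where
    lemma : ∀ x y → x ≡ (x - y) + y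
    lemma = solve-∀ ℚ-ring

  x≡y⇒x-y≡0 : ∀ {x y} → x ≡ y → x - y ≡ 0ℚ
  x≡y⇒x-y≡0 {x} refl = +-inverseʳ x

  *≡0⇒ : ∀ {x y} → x ≢ 0ℚ → x * y ≡ 0ℚ → y ≡ 0ℚ
  *≡0⇒ {x} {y} x≢0 xy≡0 with x⁻¹ , xx⁻¹ ← inverse x x≢0 =
    trans (lemma x⁻¹ x y) (trans (cong₂ (λ a b → x⁻¹ * a + (1ℚ - b) * y) xy≡0 xx⁻¹) (lemma′ x⁻¹ y))
    where
    lemma : ∀ x⁻¹ x y → y ≡ x⁻¹ * (x * y) + (1ℚ - x * x⁻¹) * y
    lemma = solve-∀ ℚ-ring
    lemma′ : ∀ x⁻¹ y → x⁻¹ * 0ℚ + (1ℚ - 1ℚ) * y ≡ 0ℚ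
    lemma′ = solve-∀ ℚ-ring

  *-cancelˡ-≢0 : ∀ {x} y z → x ≢ 0ℚ → x * y ≡ x * z → y ≡ z
  *-cancelˡ-≢0 {x} y z x≢0 eq = x-y≡0⇒x≡y (*≡0⇒ x≢0 (trans (lemma x y z) (x≡y⇒x-y≡0 eq)))
    where
    lemma : ∀ x y z → x * (y - z) ≡ x * y - x * z
    lemma = solve-∀ ℚ-ring

  *-≢0 : ∀ {x y} → x ≢ 0ℚ → y ≢ 0ℚ → x * y ≢ 0ℚ
  *-≢0 x≢0 y≢0 xy≡0 = y≢0 (*≡0⇒ x≢0 xy≡0)

  -- Linear combinations: an equation x = y follows from equations aᵢ = bᵢ once
  -- x − y is a combination of the differences aᵢ − bᵢ.
  combine₁ : ∀ {x y a b} k → a ≡ b → x - y ≡ k * (a - b) → x ≡ y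
  combine₁ {a = a} k refl eq = x-y≡0⇒x≡y (trans eq (lemma k a))
    where
    lemma : ∀ k a → k * (a - a) ≡ 0ℚ
    lemma = solve-∀ ℚ-ring

  combine₂ : ∀ {x y a b c d} k l → a ≡ b → c ≡ d → x - y ≡ k * (a - b) + l * (c - d) → x ≡ y
  combine₂ {a = a} {c = c} k l refl refl eq = x-y≡0⇒x≡y (trans eq (lemma k a l c))
    where
    lemma : ∀ k a l c → k * (a - a) + l * (c - c) ≡ 0ℚ
    lemma = solve-∀ ℚ-ring

  combine₃ : ∀ {x y a b c d e f} k l m → a ≡ b → c ≡ d → e ≡ f →
    x - y ≡ k * (a - b) + l * (c - d) + m * (e - f) → x ≡ y
  combine₃ {a = a} {c = c} {e = e} k l m refl refl refl eq = x-y≡0⇒x≡y (trans eq (lemma k a l c m e))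
    where
    lemma : ∀ k a l c m e → k * (a - a) + l * (c - c) + m * (e - e) ≡ 0ℚ
    lemma = solve-∀ ℚ-ring

-- Localisation at 1 + N ℤ and drifting sequences

Integral : ℚ → Set
Integral x = ∃ λ i → x ≡ ι i

Integral-ι : ∀ i → Integral (ι i)
Integral-ι i = i , refl

Integral-ℕ : ∀ n → Integral ℚ[ n ]
Integral-ℕ n = + n , sym (ι-ℕ n)

Integral-+ : ∀ {x y} → Integral x → Integral y → Integral (x + y)
Integral-+ (i , refl) (j , refl) = i ℤ.+ j , sym (ι-+ i j)

Integral-* : ∀ {x y} → Integral x → Integral y → Integral (x * y)
Integral-* (i , refl) (j , refl) = i ℤ.* j , sym (ι-* i j)

Integral-neg : ∀ {x} → Integral x → Integral (- x)
Integral-neg (i , refl) = ℤ.- i , sym (ι-neg i)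

module Localisation (N : ℕ) (1<N : 1 ℕ.< N) where

  L : ℚ
  L = ι (+ N)

  N∣1+N*i : ∀ n → Integral n → ∀ m → ι (+ m) + L * n ≡ 0ℚ → N ℕ.∣ m
  N∣1+N*i _ (i , refl) m eq = ℤˢ.∣⇒∣ᵤ {+ N} {+ m} (ℤˢ.divides {+ N} {+ m} (ℤ.- i) (ι-injective {+ m} {ℤ.- i ℤ.* + N} (
    trans (combine₁ 1ℚ eq (lemma (ι (+ m)) L (ι i))) (trans (cong (λ x → x * L) (sym (ι-neg i))) (sym (ι-* (ℤ.- i) (+ N)))))))
    where
    lemma : ∀ m L n → m - (- n) * L ≡ 1ℚ * ((m + L * n) - 0ℚ)
    lemma = solve-∀ ℚ-ring

  1+L*≢0 : ∀ {n} → Integral n → 1ℚ + L * n ≢ 0ℚ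
  1+L*≢0 {n} n-int eq = contradiction (ℕ.∣1⇒≡1 (N∣1+N*i n n-int 1 (trans (cong (λ x → x + L * n) (ι-ℕ 1)) eq))) λ N≡1 → ℕ.<⇒≢ 1<N (sym N≡1)

  -- The elements a / (1 + N k) with a and k integers: the localisation of ℤ at 1 + N ℤ.
  record Local (x : ℚ) : Set where
    constructor local
    field
      {k a} : ℚ
      k-int : Integral k
      a-int : Integral a
      fraction : x * (1ℚ + L * k) ≡ a

  opaque
    Local-int : ∀ {x} → Integral x → Local x
    Local-int {x} x-int = local (Integral-ℕ 0) x-int (lemma x L)
      where
      lemma : ∀ x L → x * (1ℚ + L * 0ℚ) ≡ x
      lemma = solve-∀ ℚ-ring

  private
    denominator-* : ∀ {k l} → Integral k → Integral l → Integral (k + l + L * k * l)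
    denominator-* k-int l-int =
      Integral-+ (Integral-+ k-int l-int) (Integral-* (Integral-* (Integral-ι (+ N)) k-int) l-int)

    1+L*-int : ∀ {k} → Integral k → Integral (1ℚ + L * k)
    1+L*-int k-int = Integral-+ (Integral-ℕ 1) (Integral-* (Integral-ι (+ N)) k-int)

  opaque
    Local-+ : ∀ {x y} → Local x → Local y → Local (x + y)
    Local-+ {x} {y} (local {k} {a} ki ai eq) (local {l} {b} li bi eq′) = local (denominator-* ki li)
      (Integral-+ (Integral-* ai (1+L*-int li)) (Integral-* bi (1+L*-int ki)))
      (combine₂ (1ℚ + L * l) (1ℚ + L * k) eq eq′ (lemma L x y k l a b))
      where
      lemma : ∀ L x y k l a b → (x + y) * (1ℚ + L * (k + l + L * k * l)) - (a * (1ℚ + L * l) + b * (1ℚ + L * k))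
        ≡ (1ℚ + L * l) * (x * (1ℚ + L * k) - a) + (1ℚ + L * k) * (y * (1ℚ + L * l) - b)
      lemma = solve-∀ ℚ-ring

    Local-* : ∀ {x y} → Local x → Local y → Local (x * y)
    Local-* {x} {y} (local {k} {a} ki ai eq) (local {l} {b} li bi eq′) = local (denominator-* ki li)
      (Integral-* ai bi)
      (trans (lemma L x y k l) (cong₂ _*_ eq eq′))
      where
      lemma : ∀ L x y k l → (x * y) * (1ℚ + L * (k + l + L * k * l)) ≡ (x * (1ℚ + L * k)) * (y * (1ℚ + L * l))
      lemma = solve-∀ ℚ-ring

    Local-neg : ∀ {x} → Local x → Local (- x)
    Local-neg {x} (local {k} {a} ki ai eq) = local ki (Integral-neg ai) (trans (lemma x (1ℚ + L * k)) (cong -_ eq))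
      where
      lemma : ∀ x y → (- x) * y ≡ - (x * y)
      lemma = solve-∀ ℚ-ring

    Local-- : ∀ {x y} → Local x → Local y → Local (x - y)
    Local-- x y = Local-+ x (Local-neg y)

    Local-L : Local L
    Local-L = Local-int (Integral-ι (+ N))

    Local-1 : Local 1ℚ
    Local-1 = Local-int (Integral-ℕ 1)

    Local-0 : Local 0ℚ
    Local-0 = Local-int (Integral-ℕ 0)

    unit-inverse : ∀ {r} → Local r → ∃ λ v → Local v × (1ℚ + L * r) * v ≡ 1ℚ
    unit-inverse {r} (local {k} {a} ki ai eq)
      with E⁻¹ , EE⁻¹≡1 ← inverse (1ℚ + L * (k + a)) (1+L*≢0 (Integral-+ ki ai)) =
      (1ℚ + L * k) * E⁻¹ ,
      local (Integral-+ ki ai) (1+L*-int ki) (combine₁ (1ℚ + L * k) EE⁻¹≡1 (lemma₁ L k a E⁻¹)) ,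
      combine₂ (L * E⁻¹) 1ℚ eq EE⁻¹≡1 (lemma₂ L k a r E⁻¹)
      where
      lemma₁ : ∀ L k a e → (1ℚ + L * k) * e * (1ℚ + L * (k + a)) - (1ℚ + L * k) ≡ (1ℚ + L * k) * ((1ℚ + L * (k + a)) * e - 1ℚ)
      lemma₁ = solve-∀ ℚ-ring
      lemma₂ : ∀ L k a r e → (1ℚ + L * r) * ((1ℚ + L * k) * e) - 1ℚ ≡ (L * e) * (r * (1ℚ + L * k) - a) + 1ℚ * ((1ℚ + L * (k + a)) * e - 1ℚ)
      lemma₂ = solve-∀ ℚ-ring

    n+L*≡0⇒N∣n : ∀ n {r} → Local r → ι (+ n) + L * r ≡ 0ℚ → N ℕ.∣ n
    n+L*≡0⇒N∣n n {r} (local {k} {a} ki ai eq) n+Lr≡0 =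
      N∣1+N*i (ι (+ n) * k + a) (Integral-+ (Integral-* (Integral-ι (+ n)) ki) ai) n
        (combine₂ (1ℚ + L * k) (- L) n+Lr≡0 eq (lemma (ι (+ n)) L k a r))
      where
      lemma : ∀ n L k a r → n + L * (n * k + a) - 0ℚ ≡ (1ℚ + L * k) * (n + L * r - 0ℚ) + (- L) * (r * (1ℚ + L * k) - a)
      lemma = solve-∀ ℚ-ring

  infix 4 _∣_
  record _∣_ (d x : ℚ) : Set where
    constructor divides
    field
      {quotient} : ℚ
      quotient-local : Local quotient
      equality : x ≡ d * quotient

  opaque
    ∣-+ : ∀ {d x y} → d ∣ x → d ∣ y → d ∣ x + y
    ∣-+ {d} (divides {r} r-loc refl) (divides {s} s-loc refl) = divides (Local-+ r-loc s-loc) (sym (*-distribˡ-+ d r s))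

    ∣-* : ∀ {d e x y} → d ∣ x → e ∣ y → d * e ∣ x * y
    ∣-* {d} {e} (divides {r} r-loc refl) (divides {s} s-loc refl) = divides (Local-* r-loc s-loc) (lemma d e r s)
      where
      lemma : ∀ d e r s → d * r * (e * s) ≡ d * e * (r * s)
      lemma = solve-∀ ℚ-ring

    ∣-*ʳ : ∀ {d x y} → d ∣ x → Local y → d ∣ x * y
    ∣-*ʳ {d} (divides {r} r-loc refl) y-loc = divides (Local-* r-loc y-loc) (*-assoc d r _)

    ∣-refl : ∀ {d} → d ∣ d
    ∣-refl {d} = divides Local-1 (sym (*-identityʳ d))

    ∣-neg : ∀ {d x} → d ∣ x → d ∣ - x
    ∣-neg {d} (divides {r} r-loc refl) = divides (Local-neg r-loc) (neg-distribʳ-* d r)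

    ∣-- : ∀ {d x y} → d ∣ x → d ∣ y → d ∣ x - y
    ∣-- d∣x d∣y = ∣-+ d∣x (∣-neg d∣y)

    ∣-trans-* : ∀ {d e c x} → d ∣ e → e * c ∣ x → d * c ∣ x
    ∣-trans-* {d} {_} {c} (divides {r} r-loc refl) (divides {s} s-loc refl) = divides (Local-* r-loc s-loc) (lemma d r c s)
      where
      lemma : ∀ d r c s → d * r * c * s ≡ d * c * (r * s)
      lemma = solve-∀ ℚ-ring

    ∣-weaken : ∀ {d c x} → Local c → d * c ∣ x → d ∣ x
    ∣-weaken {d} {c} c-loc (divides r-loc eq) = divides (Local-* c-loc r-loc) (trans eq (*-assoc d c _))

    Local-∣ : ∀ {d x} → Local d → d ∣ x → Local x
    Local-∣ d-loc (divides {r} r-loc refl) = Local-* d-loc r-loc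

  -- Along a sequence whose increments are close to q, and closer to each other the closer the
  -- positions are, the N-th increment sums have the same property with N q in place of q.
  record Drift (T : ℕ → ℚ) (q : ℚ) : Set where
    field
      increment : ∀ i → q * L ∣ T (suc i) - T i - q
      lipschitz : ∀ i j → (T i - T j) * (L * L) ∣ (T (suc i) - T i) - (T (suc j) - T j)

  module _ {T : ℕ → ℚ} {q : ℚ} (drift : Drift T q) where
    open Drift drift

    displacement : ∀ n b → q * L ∣ T (n ℕ.+ b) - T b - q * ι (+ n)
    displacement zero b = divides Local-0 (trans (cong (λ x → T b - T b - q * x) (ι-ℕ 0)) (lemma (T b) q L))
      where
      lemma : ∀ t q L → t - t - q * 0ℚ ≡ q * L * 0ℚ
      lemma = solve-∀ ℚ-ring
    displacement (suc n) b = subst (q * L ∣_) (trans (lemma (T (suc (n ℕ.+ b))) (T (n ℕ.+ b)) (T b) q (ι (+ n)))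
        (cong (λ x → T (suc (n ℕ.+ b)) - T b - q * x) (sym (ι-suc n))))
      (∣-+ (increment (n ℕ.+ b)) (displacement n b))
      where
      lemma : ∀ t u v q n → t - u - q + (u - v - q * n) ≡ t - v - q * (1ℚ + n)
      lemma = solve-∀ ℚ-ring

    displacement-multiple : ∀ n b → q ∣ T (n ℕ.+ b) - T b
    displacement-multiple n b with divides {r} r-loc eq ← displacement n b =
      divides (Local-+ (Local-* Local-L r-loc) (Local-int (Integral-ι (+ n))))
      (combine₁ 1ℚ eq (lemma (T (n ℕ.+ b) - T b) q (ι (+ n)) L r))
      where
      lemma : ∀ d q n L r → d - q * (L * r + n) ≡ 1ℚ * (d - q * n - q * L * r)
      lemma = solve-∀ ℚ-ring

    displacement-linear : ∀ n b → q * (L * L) ∣ T (n ℕ.+ b) - T b - ι (+ n) * (T (suc b) - T b)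
    displacement-linear zero b = divides Local-0 (trans (cong (λ x → T b - T b - x * (T (suc b) - T b)) (ι-ℕ 0)) (lemma (T b) q (L * L) (T (suc b) - T b)))
      where
      lemma : ∀ t q L d → t - t - 0ℚ * d ≡ q * L * 0ℚ
      lemma = solve-∀ ℚ-ring
    displacement-linear (suc n) b = subst (q * (L * L) ∣_)
        (trans (lemma (T (suc (n ℕ.+ b))) (T (n ℕ.+ b)) (T b) (T (suc b) - T b) (ι (+ n)))
          (cong (λ x → T (suc (n ℕ.+ b)) - T b - x * (T (suc b) - T b)) (sym (ι-suc n))))
        (∣-+ (∣-trans-* (displacement-multiple n b) (lipschitz (n ℕ.+ b) b)) (displacement-linear n b))
      where
      lemma : ∀ t u v d n → (t - u) - d + (u - v - n * d) ≡ t - v - (1ℚ + n) * d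
      lemma = solve-∀ ℚ-ring

    displacement-lipschitz : ∀ n b c → (T b - T c) * (L * L) ∣ (T (n ℕ.+ b) - T b) - (T (n ℕ.+ c) - T c)
    displacement-lipschitz zero b c = divides Local-0 (lemma (T b) (T c) L)
      where
      lemma : ∀ t u L → (t - t) - (u - u) ≡ (t - u) * (L * L) * 0ℚ
      lemma = solve-∀ ℚ-ring
    displacement-lipschitz (suc n) b c = subst ((T b - T c) * (L * L) ∣_)
        (lemma₂ (T (suc (n ℕ.+ b))) (T (n ℕ.+ b)) (T b) (T (suc (n ℕ.+ c))) (T (n ℕ.+ c)) (T c))
        (∣-+ (displacement-lipschitz n b c) (∣-trans-* close (lipschitz (n ℕ.+ b) (n ℕ.+ c))))
      where
      lemma₁ : ∀ b₁ b₀ c₁ c₀ → (b₀ - c₀) + ((b₁ - b₀) - (c₁ - c₀)) ≡ b₁ - c₁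
      lemma₁ = solve-∀ ℚ-ring
      lemma₂ : ∀ b₂ b₁ b₀ c₂ c₁ c₀ → ((b₁ - b₀) - (c₁ - c₀)) + ((b₂ - b₁) - (c₂ - c₁)) ≡ (b₂ - b₀) - (c₂ - c₀)
      lemma₂ = solve-∀ ℚ-ring
      close : T b - T c ∣ T (n ℕ.+ b) - T (n ℕ.+ c)
      close = subst (T b - T c ∣_) (lemma₁ (T (n ℕ.+ b)) (T b) (T (n ℕ.+ c)) (T c))
        (∣-+ ∣-refl (∣-weaken (Local-* Local-L Local-L) (displacement-lipschitz n b c)))

    drift-subsequence : Drift (λ i → T (i ℕ.* N)) (q * L)
    drift-subsequence = record
      { increment = λ i → increment′ (i ℕ.* N)
      ; lipschitz = λ i j → displacement-lipschitz N (i ℕ.* N) (j ℕ.* N)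
      }
      where
      increment′ : ∀ b → q * L * L ∣ T (N ℕ.+ b) - T b - q * L
      increment′ b with divides {r} r-loc eq ← displacement-linear N b | divides {s} s-loc eq′ ← increment b =
        divides (Local-+ r-loc s-loc)
        (combine₂ 1ℚ L eq eq′ (lemma (T (N ℕ.+ b) - T b) (T (suc b) - T b) q L r s))
        where
        lemma : ∀ e d q L r s → e - q * L - q * L * L * (r + s)
          ≡ 1ℚ * (e - L * d - q * (L * L) * r) + L * (d - q - q * L * s)
        lemma = solve-∀ ℚ-ring

  NoReturn : ℕ → Set
  NoReturn n = ∀ (T : ℕ → ℚ) q → q ≢ 0ℚ → Drift T q → n ≢ 0 → T n ≢ T 0

  L≢0 : L ≢ 0ℚ
  L≢0 L≡0 = ℕ.<⇒≢ (ℕ.<-trans ℕ.z<s 1<N) (sym (ℤ.+-injective (ι-injective {+ N} {+ 0} (trans L≡0 (sym (ι-ℕ 0))))))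

  no-return : ∀ n → NoReturn n
  no-return = <-rec NoReturn step
    where
    step : ∀ n → (∀ {m} → m ℕ.< n → NoReturn m) → NoReturn n
    step n ih T q q≢0 drift n≢0 Tn≡T0 with N ℕ.∣? n
    ... | yes (ℕ.divides zero refl) = n≢0 refl
    ... | yes (ℕ.divides m@(suc _) refl) =
      ih (ℕ.m<m*n m N 1<N) (λ i → T (i ℕ.* N)) (q * L) (*-≢0 q≢0 L≢0) (drift-subsequence drift) (λ ()) Tn≡T0
    ... | no N∤n with divides {r} r-loc eq ← displacement drift n 0 =
      N∤n (n+L*≡0⇒N∣n n r-loc (*≡0⇒ q≢0 (combine₂ 1ℚ (- 1ℚ) T[n+0]≡T0 eq (lemma (T (n ℕ.+ 0)) (T 0) q (ι (+ n)) L r))))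
      where
      T[n+0]≡T0 : T (n ℕ.+ 0) ≡ T 0
      T[n+0]≡T0 = trans (cong T (ℕ.+-identityʳ n)) Tn≡T0
      lemma : ∀ t u q n L r → q * (n + L * r) - 0ℚ ≡ 1ℚ * (t - u) + (- 1ℚ) * (t - u - q * n - q * L * r)
      lemma = solve-∀ ℚ-ring

-- The chord-tangent law

2ℚ 3ℚ : ℚ
2ℚ = ℚ[ 2 ]
3ℚ = ℚ[ 3 ]

-- The curve y² = x³ + a x² + e, put into the form Y² = X³ + A X + B by X = μ² x − s, Y = μ³ y.
module Model (A a s μ : ℚ) (μ≢0 : μ ≢ 0ℚ) (μμa≡-3s : μ * μ * a ≡ - (3ℚ * s)) (A≡-3ss : A ≡ - (3ℚ * s * s)) where

  E : ℚ → ℚ → Point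
  E x y = pt (μ * μ * x - s) (μ * μ * μ * y)

  third-x : ℚ → ℚ → ℚ → ℚ
  third-x m x₁ x₂ = m * m - a - x₁ - x₂

  third : ℚ → ℚ → ℚ → ℚ → Point
  third m x₁ y₁ x₂ = E (third-x m x₁ x₂) (m * (x₁ - third-x m x₁ x₂) - y₁)

  chord-E : ∀ {l} m x₁ y₁ x₂ → l ≡ μ * m →
    chord l (μ * μ * x₁ - s) (μ * μ * μ * y₁) (μ * μ * x₂ - s) ≡ third m x₁ y₁ x₂
  chord-E m x₁ y₁ x₂ refl = cong₂ pt (combine₁ 1ℚ μμa≡-3s (lemma₁ m x₁ x₂ μ a s))
      (combine₁ (- (μ * m)) μμa≡-3s (lemma₂ m x₁ y₁ x₂ μ a s))
    where
    lemma₁ : ∀ m x₁ x₂ μ a s →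
      (μ * m) * (μ * m) - (μ * μ * x₁ - s) - (μ * μ * x₂ - s) - (μ * μ * (m * m - a - x₁ - x₂) - s)
        ≡ 1ℚ * (μ * μ * a - (- (ℚ[ 3 ] * s)))
    lemma₁ = solve-∀ ℚ-ring
    lemma₂ : ∀ m x₁ y₁ x₂ μ a s →
      (μ * m) * ((μ * μ * x₁ - s) - ((μ * m) * (μ * m) - (μ * μ * x₁ - s) - (μ * μ * x₂ - s))) - μ * μ * μ * y₁
          - (μ * μ * μ * (m * (x₁ - (m * m - a - x₁ - x₂)) - y₁))
        ≡ (- (μ * m)) * (μ * μ * a - (- (ℚ[ 3 ] * s)))
    lemma₂ = solve-∀ ℚ-ring

  private
    X-difference : ∀ x₁ x₂ μ s → (μ * μ * x₂ - s) - (μ * μ * x₁ - s) ≡ (μ * μ) * (x₂ - x₁)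
    X-difference = solve-∀ ℚ-ring

    Y-sum : ∀ y₁ y₂ μ → μ * μ * μ * y₁ + μ * μ * μ * y₂ ≡ (μ * μ * μ) * (y₁ + y₂)
    Y-sum = solve-∀ ℚ-ring

    μμ≢0 : μ * μ ≢ 0ℚ
    μμ≢0 = *-≢0 μ≢0 μ≢0

    μμμ≢0 : μ * μ * μ ≢ 0ℚ
    μμμ≢0 = *-≢0 μμ≢0 μ≢0

    quotient-unique : ∀ {x y k} .{{_ : NonZero y}} → x ≡ k * y → x ÷ y ≡ k
    quotient-unique {x} {y} {k} refl = trans (*-assoc k y (1/ y)) (trans (cong (k *_) (*-inverseʳ y)) (*-identityʳ k))

  add-chord : ∀ {m x₁ y₁ x₂ y₂} → x₁ ≢ x₂ → m * (x₂ - x₁) ≡ y₂ - y₁ →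
    add A (E x₁ y₁) (E x₂ y₂) ≡ third m x₁ y₁ x₂
  add-chord {m} {x₁} {y₁} {x₂} {y₂} x₁≢x₂ slope with (μ * μ * x₂ - s) - (μ * μ * x₁ - s) ≟ 0ℚ
  ... | yes X≡0 = contradiction (sym (x-y≡0⇒x≡y (*≡0⇒ μμ≢0 (trans (sym (X-difference x₁ x₂ μ s)) X≡0)))) x₁≢x₂
  ... | no X≢0 = chord-E m x₁ y₁ x₂ (quotient-unique {μ * μ * μ * y₂ - μ * μ * μ * y₁} {(μ * μ * x₂ - s) - (μ * μ * x₁ - s)} {{≢-nonZero X≢0}}
      (combine₁ (- (μ * μ * μ)) slope (lemma m x₁ y₁ x₂ y₂ μ s)))
    where
    lemma : ∀ m x₁ y₁ x₂ y₂ μ s →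
      (μ * μ * μ * y₂ - μ * μ * μ * y₁) - (μ * m) * ((μ * μ * x₂ - s) - (μ * μ * x₁ - s))
        ≡ (- (μ * μ * μ)) * (m * (x₂ - x₁) - (y₂ - y₁))
    lemma = solve-∀ ℚ-ring

  add-tangent : ∀ {m x y} → y + y ≢ 0ℚ → m * (y + y) ≡ 3ℚ * x * x + 2ℚ * a * x →
    add A (E x y) (E x y) ≡ third m x y x
  add-tangent {m} {x} {y} y+y≢0 slope with (μ * μ * x - s) - (μ * μ * x - s) ≟ 0ℚ
  ... | no X≢0 = contradiction (+-inverseʳ (μ * μ * x - s)) X≢0
  ... | yes _ with μ * μ * μ * y + μ * μ * μ * y ≟ 0ℚ
  ...   | yes Y≡0 = contradiction (*≡0⇒ μμμ≢0 (trans (sym (Y-sum y y μ)) Y≡0)) y+y≢0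
  ...   | no Y≢0 = chord-E m x y x (quotient-unique {ℚ[ 3 ] * (μ * μ * x - s) * (μ * μ * x - s) + A} {μ * μ * μ * y + μ * μ * μ * y} {{≢-nonZero Y≢0}}
      (combine₃ (- (μ * μ * μ * μ)) (- (2ℚ * μ * μ * x)) 1ℚ slope μμa≡-3s A≡-3ss (lemma m x y μ a s A)))
    where
    lemma : ∀ m x y μ a s A →
      (ℚ[ 3 ] * (μ * μ * x - s) * (μ * μ * x - s) + A) - (μ * m) * (μ * μ * μ * y + μ * μ * μ * y)
        ≡ (- (μ * μ * μ * μ)) * (m * (y + y) - (ℚ[ 3 ] * x * x + ℚ[ 2 ] * a * x))
          + (- (ℚ[ 2 ] * μ * μ * x)) * (μ * μ * a - (- (ℚ[ 3 ] * s)))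
          + 1ℚ * (A - (- (ℚ[ 3 ] * s * s)))
    lemma = solve-∀ ℚ-ring

  add-opposite : ∀ {x y₁ y₂} → y₁ + y₂ ≡ 0ℚ → add A (E x y₁) (E x y₂) ≡ O
  add-opposite {x} {y₁} {y₂} y₁+y₂≡0 with (μ * μ * x - s) - (μ * μ * x - s) ≟ 0ℚ
  ... | no X≢0 = contradiction (+-inverseʳ (μ * μ * x - s)) X≢0
  ... | yes _ with μ * μ * μ * y₁ + μ * μ * μ * y₂ ≟ 0ℚ
  ...   | yes _ = refl
  ...   | no Y≢0 = contradiction (trans (Y-sum y₁ y₂ μ) (trans (cong (μ * μ * μ *_) y₁+y₂≡0) (*-zeroʳ (μ * μ * μ)))) Y≢0

-- In the coordinates z = x / y, w = 1 / y the curve y² = x³ + a x² + e becomes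
-- w = z³ + a z² w + e w³, with the point at infinity at the origin.
module AtInfinity (a e : ℚ) where

  OnCurve∞ : ℚ → ℚ → Set
  OnCurve∞ z w = w ≡ z * z * z + a * z * z * w + e * w * w * w

  rise run : ℚ → ℚ → ℚ → ℚ → ℚ
  rise z w z₀ w₀ = z * z + z * z₀ + z₀ * z₀ + a * w₀ * (z + z₀)
  run z w z₀ w₀ = 1ℚ + (- (a * z * z + e * (w * w + w * w₀ + w₀ * w₀)))

  line-through : ∀ {z w z₀ w₀} l → OnCurve∞ z w → OnCurve∞ z₀ w₀ → run z w z₀ w₀ ≢ 0ℚ →
    l * run z w z₀ w₀ ≡ rise z w z₀ w₀ → w - w₀ ≡ l * (z - z₀)
  line-through {z} {w} {z₀} {w₀} l curve curve₀ run≢0 slope = *-cancelˡ-≢0 (w - w₀) (l * (z - z₀)) run≢0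
    (combine₃ 1ℚ (- 1ℚ) (- (z - z₀)) curve curve₀ slope (lemma z w z₀ w₀ l a e))
    where
    lemma : ∀ z w z₀ w₀ l a e →
      (1ℚ + (- (a * z * z + e * (w * w + w * w₀ + w₀ * w₀)))) * (w - w₀)
          - (1ℚ + (- (a * z * z + e * (w * w + w * w₀ + w₀ * w₀)))) * (l * (z - z₀))
        ≡ 1ℚ * (w - (z * z * z + a * z * z * w + e * w * w * w))
          + (- 1ℚ) * (w₀ - (z₀ * z₀ * z₀ + a * z₀ * z₀ * w₀ + e * w₀ * w₀ * w₀))
          + (- (z - z₀)) * (l * (1ℚ + (- (a * z * z + e * (w * w + w * w₀ + w₀ * w₀)))) - (z * z + z * z₀ + z₀ * z₀ + a * w₀ * (z + z₀)))
    lemma = solve-∀ ℚ-ring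

  -- c₃ ζ³ + c₂ ζ² + c₁ ζ + c₀ is the equation of the curve restricted to the line w = l ζ + n.
  c₃ : ℚ → ℚ
  c₃ l = 1ℚ + a * l + e * l * l * l

  c₂ c₁ c₀ : ℚ → ℚ → ℚ
  c₂ l n = n * (a + 3ℚ * e * l * l)
  c₁ l n = 3ℚ * e * l * n * n - l
  c₀ l n = e * n * n * n - n

  -- Vieta's formulas for the roots z, z₀ and − z′.
  record Intersection (l n z z₀ z′ : ℚ) : Set where
    field
      vieta₂ : c₂ l n ≡ c₃ l * (z′ - z - z₀)
      vieta₁ : c₁ l n ≡ c₃ l * (z * z₀ - (z + z₀) * z′)
      vieta₀ : c₀ l n ≡ c₃ l * (z * z₀ * z′)

  intersection : ∀ {l n z w z₀ w₀ z′} → w ≡ l * z + n → w₀ ≡ l * z₀ + n → OnCurve∞ z₀ w₀ →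
    l * run z w z₀ w₀ ≡ rise z w z₀ w₀ → c₃ l * (z′ - z - z₀) ≡ c₂ l n → Intersection l n z z₀ z′
  intersection {l} {n} {z} {_} {z₀} {_} {z′} refl refl curve₀ slope third = record
    { vieta₂ = sym third
    ; vieta₁ = v₁
    ; vieta₀ = combine₃ (- 1ℚ) (- z₀) (z₀ * z₀) (trans curve₀ (root l n z₀ a e)) v₁ third
        (lemma₀ (c₀ l n) (c₁ l n) (c₂ l n) (c₃ l) z z₀ z′ (l * z₀ + n))
    }
    where
    lemma₁ : ∀ l n z z₀ z′ a e → let w = l * z + n; w₀ = l * z₀ + n; c₃ = 1ℚ + a * l + e * l * l * l in
      (ℚ[ 3 ] * e * l * n * n - l) - c₃ * (z * z₀ - (z + z₀) * z′)
        ≡ (- 1ℚ) * (l * (1ℚ + (- (a * z * z + e * (w * w + w * w₀ + w₀ * w₀)))) - (z * z + z * z₀ + z₀ * z₀ + a * w₀ * (z + z₀)))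
          + (z + z₀) * (c₃ * (z′ - z - z₀) - n * (a + ℚ[ 3 ] * e * l * l))
    lemma₁ = solve-∀ ℚ-ring
    v₁ : c₁ l n ≡ c₃ l * (z * z₀ - (z + z₀) * z′)
    v₁ = combine₂ (- 1ℚ) (z + z₀) slope third (lemma₁ l n z z₀ z′ a e)
    root : ∀ l n z₀ a e → let w₀ = l * z₀ + n in z₀ * z₀ * z₀ + a * z₀ * z₀ * w₀ + e * w₀ * w₀ * w₀
      ≡ w₀ + ((1ℚ + a * l + e * l * l * l) * z₀ * z₀ * z₀ + n * (a + ℚ[ 3 ] * e * l * l) * z₀ * z₀ + (ℚ[ 3 ] * e * l * n * n - l) * z₀ + (e * n * n * n - n))
    root = solve-∀ ℚ-ring
    lemma₀ : ∀ c₀ c₁ c₂ c₃ z z₀ z′ w₀ → c₀ - c₃ * (z * z₀ * z′)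
      ≡ (- 1ℚ) * (w₀ - (w₀ + (c₃ * z₀ * z₀ * z₀ + c₂ * z₀ * z₀ + c₁ * z₀ + c₀)))
        + (- z₀) * (c₁ - c₃ * (z * z₀ - (z + z₀) * z′)) + z₀ * z₀ * (c₃ * (z′ - z - z₀) - c₂)
    lemma₀ = solve-∀ ℚ-ring

  module _ {l n z z₀ z′ : ℚ} (meet : Intersection l n z z₀ z′) where
    open Intersection meet

    reflected-on-curve : OnCurve∞ z′ (l * z′ - n)
    reflected-on-curve = combine₃ (z′ * z′) (- z′) 1ℚ vieta₂ vieta₁ vieta₀
      (trans (lemma₁ l n z′ a e) (lemma₂ (c₀ l n) (c₁ l n) (c₂ l n) (c₃ l) z z₀ z′))
      where
      lemma₁ : ∀ l n z′ a e → let w′ = l * z′ - n in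
        w′ - (z′ * z′ * z′ + a * z′ * z′ * w′ + e * w′ * w′ * w′)
          ≡ z′ * z′ * (n * (a + ℚ[ 3 ] * e * l * l)) - z′ * (ℚ[ 3 ] * e * l * n * n - l) + (e * n * n * n - n) - (1ℚ + a * l + e * l * l * l) * z′ * z′ * z′
      lemma₁ = solve-∀ ℚ-ring
      lemma₂ : ∀ c₀ c₁ c₂ c₃ z z₀ z′ → z′ * z′ * c₂ - z′ * c₁ + c₀ - c₃ * z′ * z′ * z′
        ≡ z′ * z′ * (c₂ - c₃ * (z′ - z - z₀)) + (- z′) * (c₁ - c₃ * (z * z₀ - (z + z₀) * z′)) + 1ℚ * (c₀ - c₃ * (z * z₀ * z′))
      lemma₂ = solve-∀ ℚ-ring

    -- n² w w₀ times the equation (l z′ − n) x = z′ for the first coordinate x of the reflected third point.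
    reflected-x : c₃ l ≢ 0ℚ → let W = l * l * (z * z₀) + l * n * (z + z₀) + n * n in
      (l * z′ - n) * (W * (l * l - n * n * a) - n * n * (2ℚ * l * (z * z₀) + n * (z + z₀))) ≡ z′ * (n * n) * W
    reflected-x c₃≢0 = *-cancelˡ-≢0 _ _ c₃≢0 (combine₃
        (n * n * n * n - l * n * n * (l * l - n * n * a))
        (l * (l * n * (l * l - n * n * a) - n * n * n) - n * n * n * l)
        (n * n * l * l - l * (l * l * (l * l - n * n * a) - 2ℚ * l * n * n))
        (trans vieta₂ (cong (c₃ l *_) (difference z z₀ z′))) vieta₁ vieta₀
        (lemma l n (z + z₀) (z * z₀) z′ a e))
      where
      difference : ∀ z z₀ z′ → z′ - z - z₀ ≡ z′ - (z + z₀)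
      difference = solve-∀ ℚ-ring
      lemma : ∀ l n S P z′ a e → let c₃ = 1ℚ + a * l + e * l * l * l; W = l * l * P + l * n * S + n * n in
        c₃ * ((l * z′ - n) * (W * (l * l - n * n * a) - n * n * (ℚ[ 2 ] * l * P + n * S))) - c₃ * (z′ * (n * n) * W)
          ≡ (n * n * n * n - l * n * n * (l * l - n * n * a)) * (n * (a + ℚ[ 3 ] * e * l * l) - c₃ * (z′ - S))
            + (l * (l * n * (l * l - n * n * a) - n * n * n) - n * n * n * l) * ((ℚ[ 3 ] * e * l * n * n - l) - c₃ * (P - S * z′))
            + (n * n * l * l - l * (l * l * (l * l - n * n * a) - ℚ[ 2 ] * l * n * n)) * ((e * n * n * n - n) - c₃ * (P * z′))
      lemma = solve-∀ ℚ-ring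

unit≢0 : ∀ {x y} → x * y ≡ 1ℚ → x ≢ 0ℚ
unit≢0 {y = y} xy≡1 refl = 1≢0 (trans (sym xy≡1) (*-zeroˡ y))

module Addition (A a s μ : ℚ) (μ≢0 : μ ≢ 0ℚ) (μμa≡-3s : μ * μ * a ≡ - (3ℚ * s)) (A≡-3ss : A ≡ - (3ℚ * s * s)) (e : ℚ) where
  open Model A a s μ μ≢0 μμa≡-3s A≡-3ss
  open AtInfinity a e

  private
    scaled-x : ∀ {l n m z w i z₀ w₀ i₀} → w * i ≡ 1ℚ → w₀ * i₀ ≡ 1ℚ → n * m ≡ - l →
      n * n * (w * w₀) * third-x m (z₀ * i₀) (z * i) ≡ (w * w₀) * (l * l - n * n * a) - n * n * (z₀ * w + z * w₀)
    scaled-x {l} {n} {m} {z} {w} {i} {z₀} {w₀} {i₀} wi w₀i₀ nm = combine₃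
      (w * w₀ * (n * m - l)) (- (n * n * z * w₀)) (- (n * n * z₀ * w)) nm wi w₀i₀ (lemma l n m z i z₀ i₀ w w₀ a)
      where
      lemma : ∀ l n m z i z₀ i₀ w w₀ a →
        n * n * (w * w₀) * (m * m - a - z₀ * i₀ - z * i) - ((w * w₀) * (l * l - n * n * a) - n * n * (z₀ * w + z * w₀))
          ≡ w * w₀ * (n * m - l) * (n * m - (- l)) + (- (n * n * z * w₀)) * (w * i - 1ℚ) + (- (n * n * z₀ * w)) * (w₀ * i₀ - 1ℚ)
      lemma = solve-∀ ℚ-ring

    product-on-line : ∀ l n z z₀ → (l * z + n) * (l * z₀ + n) ≡ l * l * (z * z₀) + l * n * (z + z₀) + n * n
    product-on-line = solve-∀ ℚ-ring

    cross-on-line : ∀ l n z z₀ → z₀ * (l * z + n) + z * (l * z₀ + n) ≡ ℚ[ 2 ] * l * (z * z₀) + n * (z + z₀)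
    cross-on-line = solve-∀ ℚ-ring

  curve-xy : ∀ {z w i} → OnCurve∞ z w → w * i ≡ 1ℚ → i * i ≡ (z * i) * (z * i) * (z * i) + a * (z * i) * (z * i) + e
  curve-xy {z} {w} {i} curve wi = combine₂ (i * i * i)
      (a * z * z * i * i + e * ((w * i) * (w * i) + w * i + 1ℚ) - i * i) curve wi (lemma z w i a e)
    where
    lemma : ∀ z w i a e → i * i - ((z * i) * (z * i) * (z * i) + a * (z * i) * (z * i) + e)
      ≡ i * i * i * (w - (z * z * z + a * z * z * w + e * w * w * w))
        + (a * z * z * i * i + e * ((w * i) * (w * i) + w * i + 1ℚ) - i * i) * (w * i - 1ℚ)
    lemma = solve-∀ ℚ-ring

  tangent-slope : ∀ {l z w i m} → OnCurve∞ z w → l * run z w z w ≡ rise z w z w → w * i ≡ 1ℚ → run z w z w ≢ 0ℚ →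
    m * (i + i) ≡ 3ℚ * (z * i) * (z * i) + 2ℚ * a * (z * i) → (w - l * z) * m ≡ - l
  tangent-slope {l} {z} {w} {i} {m} curve slope wi run≢0 tangent =
    *-cancelˡ-≢0 {run z w z w} ((w - l * z) * m) (- l) run≢0 (trans
      (combine₂ (- (m * z)) (3ℚ * m) slope curve (lemma₁ l m z w a e))
      (combine₃ (2ℚ * m * w - 3ℚ * z * z * (w * i + 1ℚ) - 2ℚ * a * z * w) (- (w * w)) 1ℚ wi tangent slope (lemma₂ l m z w i a (run z w z w))))
    where
    lemma₁ : ∀ l m z w a e → let run = 1ℚ + (- (a * z * z + e * (w * w + w * w + w * w))) in
      run * ((w - l * z) * m) - (- (ℚ[ 2 ] * w * m))
        ≡ (- (m * z)) * (l * run - (z * z + z * z + z * z + a * w * (z + z)))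
          + ℚ[ 3 ] * m * (w - (z * z * z + a * z * z * w + e * w * w * w))
    lemma₁ = solve-∀ ℚ-ring
    lemma₂ : ∀ l m z w i a run →
      (- (ℚ[ 2 ] * w * m)) - run * (- l)
        ≡ (ℚ[ 2 ] * m * w - ℚ[ 3 ] * z * z * (w * i + 1ℚ) - ℚ[ 2 ] * a * z * w) * (w * i - 1ℚ)
          + (- (w * w)) * (m * (i + i) - (ℚ[ 3 ] * (z * i) * (z * i) + ℚ[ 2 ] * a * (z * i)))
          + 1ℚ * (l * run - (z * z + z * z + z * z + a * w * (z + z)))
    lemma₂ = solve-∀ ℚ-ring

  Represents : Point → ℚ → ℚ → Set
  Represents P z w = ∃ λ i → w * i ≡ 1ℚ × P ≡ E (z * i) i

  module _ {l n z w z₀ w₀ z′} (on-line : w ≡ l * z + n) (on-line₀ : w₀ ≡ l * z₀ + n) (curve₀ : OnCurve∞ z₀ w₀)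
      (slope : l * run z w z₀ w₀ ≡ rise z w z₀ w₀) (third≡ : c₃ l * (z′ - z - z₀) ≡ c₂ l n)
      (c₃≢0 : c₃ l ≢ 0ℚ) (z′≢0 : z′ ≢ 0ℚ) where

    private
      meet : Intersection l n z z₀ z′
      meet = intersection on-line on-line₀ curve₀ slope third≡

      w′ : ℚ
      w′ = l * z′ - n

      w′≢0 : w′ ≢ 0ℚ
      w′≢0 w′≡0 = *-≢0 (*-≢0 z′≢0 z′≢0) z′≢0 (combine₂ (1ℚ - a * z′ * z′ - e * w′ * w′) (- 1ℚ) w′≡0 (reflected-on-curve meet) (lemma z′ w′ a e))
        where
        lemma : ∀ z w a e → z * z * z - 0ℚ
          ≡ (1ℚ - a * z * z - e * w * w) * (w - 0ℚ) + (- 1ℚ) * (w - (z * z * z + a * z * z * w + e * w * w * w))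
        lemma = solve-∀ ℚ-ring

    represents-third : ∀ {m i i₀} → n ≢ 0ℚ → n * m ≡ - l → w * i ≡ 1ℚ → w₀ * i₀ ≡ 1ℚ →
      Represents (third m (z₀ * i₀) i₀ (z * i)) z′ w′
    represents-third {m} {i} {i₀} n≢0 nm wi w₀i₀ = i′ , w′i′ , cong₂ E
        (combine₂ (- x₃) i′ w′i′ w′x₃ (lemma₁ x₃ w′ i′ z′))
        (*-cancelˡ-≢0 {w′} (m * (z₀ * i₀ - x₃) - i₀) i′ w′≢0 (trans w′y₃ (sym w′i′)))
      where
      i′ = proj₁ (inverse w′ w′≢0)
      w′i′ = proj₂ (inverse w′ w′≢0)
      x₃ = third-x m (z₀ * i₀) (z * i)
      K = n * n * (w * w₀)
      W = l * l * (z * z₀) + l * n * (z + z₀) + n * n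
      ww₀≡W : w * w₀ ≡ W
      ww₀≡W = trans (cong₂ _*_ on-line on-line₀) (product-on-line l n z z₀)
      cross : z₀ * w + z * w₀ ≡ 2ℚ * l * (z * z₀) + n * (z + z₀)
      cross = trans (cong₂ (λ u v → z₀ * u + z * v) on-line on-line₀) (cross-on-line l n z z₀)
      Kx₃ : K * x₃ ≡ W * (l * l - n * n * a) - n * n * (2ℚ * l * (z * z₀) + n * (z + z₀))
      Kx₃ = trans (scaled-x {l} {n} {m} {z} {w} {i} {z₀} {w₀} {i₀} wi w₀i₀ nm)
        (cong₂ (λ u v → u * (l * l - n * n * a) - n * n * v) ww₀≡W cross)
      lemma₁ : ∀ x w i z → x - z * i ≡ (- x) * (w * i - 1ℚ) + i * (w * x - z)
      lemma₁ = solve-∀ ℚ-ring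
      lemma₂ : ∀ k w x z → k * (w * x) ≡ w * (k * x)
      lemma₂ = solve-∀ ℚ-ring
      lemma₃ : ∀ n W z → z * (n * n) * W ≡ n * n * W * z
      lemma₃ = solve-∀ ℚ-ring
      w′x₃ : w′ * x₃ ≡ z′
      w′x₃ = *-cancelˡ-≢0 {K} (w′ * x₃) z′ (*-≢0 {n * n} {w * w₀} (*-≢0 {n} {n} n≢0 n≢0) (*-≢0 {w} {w₀} (unit≢0 {w} {i} wi) (unit≢0 {w₀} {i₀} w₀i₀)))
        (trans (lemma₂ K w′ x₃ z′) (trans (cong (w′ *_) Kx₃) (trans (reflected-x meet c₃≢0)
          (trans (lemma₃ n W z′) (cong (λ u → n * n * u * z′) (sym ww₀≡W))))))
      lemma₄ : ∀ l n m z₀ i₀ x₃ z′ → let w′ = l * z′ - n in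
        n * (w′ * (m * (z₀ * i₀ - x₃) - i₀)) - n * 1ℚ
          ≡ w′ * (z₀ * i₀ - x₃) * (n * m - (- l)) + (- w′) * ((l * z₀ + n) * i₀ - 1ℚ) + l * (w′ * x₃ - z′)
      lemma₄ = solve-∀ ℚ-ring
      w′y₃ : w′ * (m * (z₀ * i₀ - x₃) - i₀) ≡ 1ℚ
      w′y₃ = *-cancelˡ-≢0 {n} (w′ * (m * (z₀ * i₀ - x₃) - i₀)) 1ℚ n≢0 (combine₃ (w′ * (z₀ * i₀ - x₃)) (- w′) l nm
        (trans (cong (_* i₀) (sym on-line₀)) w₀i₀) w′x₃ (lemma₄ l n m z₀ i₀ x₃ z′))

    opposite⇒z′≡0 : z + z₀ ≡ 0ℚ → w + w₀ ≡ 0ℚ → z′ ≡ 0ℚ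
    opposite⇒z′≡0 zz ww = *≡0⇒ c₃≢0 (combine₃ 1ℚ (c₃ l) (a + 3ℚ * e * l * l) third≡ zz n≡0 (lemma (c₃ l) z z₀ z′ n (a + 3ℚ * e * l * l)))
      where
      lemma : ∀ c z z₀ z′ n k → c * z′ - 0ℚ ≡ 1ℚ * (c * (z′ - z - z₀) - n * k) + c * (z + z₀ - 0ℚ) + k * (n - 0ℚ)
      lemma = solve-∀ ℚ-ring
      lemma′ : ∀ l n z z₀ → ℚ[ 2 ] * n - 0ℚ ≡ 1ℚ * ((l * z + n) + (l * z₀ + n) - 0ℚ) + (- l) * (z + z₀ - 0ℚ)
      lemma′ = solve-∀ ℚ-ring
      n≡0 : n ≡ 0ℚ
      n≡0 = *≡0⇒ {2ℚ} (λ ()) (combine₂ 1ℚ (- l) (trans (cong₂ _+_ (sym on-line) (sym on-line₀)) ww) zz (lemma′ l n z z₀))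

    private
      on-line-xy : ∀ {z w i} → w ≡ l * z + n → w * i ≡ 1ℚ → l * (z * i) + n * i ≡ 1ℚ
      on-line-xy {z} {w} {i} refl wi = trans (lemma l n z i) wi
        where
        lemma : ∀ l n z i → l * (z * i) + n * i ≡ (l * z + n) * i
        lemma = solve-∀ ℚ-ring

    add-distinct : ∀ {i i₀} → w * i ≡ 1ℚ → w₀ * i₀ ≡ 1ℚ → z₀ * i₀ ≢ z * i →
      Represents (add A (E (z₀ * i₀) i₀) (E (z * i) i)) z′ w′
    add-distinct {i} {i₀} wi w₀i₀ x₀≢x =
      subst (λ P → Represents P z′ w′)
        (sym (add-chord {(i - i₀) * d} {z₀ * i₀} {i₀} {z * i} {i} x₀≢x (combine₁ (i - i₀) Δd (lemma₁ (i - i₀) d (z * i - z₀ * i₀)))))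
        (represents-third n≢0 nm wi w₀i₀)
      where
      Δ≢0 : z * i - z₀ * i₀ ≢ 0ℚ
      Δ≢0 Δ≡0 = x₀≢x (sym (x-y≡0⇒x≡y Δ≡0))
      d = proj₁ (inverse (z * i - z₀ * i₀) Δ≢0)
      Δd = proj₂ (inverse (z * i - z₀ * i₀) Δ≢0)
      lemma₁ : ∀ y d x → y * d * x - y ≡ y * (x * d - 1ℚ)
      lemma₁ = solve-∀ ℚ-ring
      lemma₂ : ∀ l n x x₀ i i₀ d → n * ((i - i₀) * d) - (- l)
        ≡ d * (l * x + n * i - 1ℚ) + (- d) * (l * x₀ + n * i₀ - 1ℚ) + (- l) * ((x - x₀) * d - 1ℚ)
      lemma₂ = solve-∀ ℚ-ring
      nm : n * ((i - i₀) * d) ≡ - l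
      nm = combine₃ d (- d) (- l) (on-line-xy on-line wi) (on-line-xy on-line₀ w₀i₀) Δd (lemma₂ l n (z * i) (z₀ * i₀) i i₀ d)
      lemma₃ : ∀ l x i n d m → 1ℚ - 0ℚ ≡ (- 1ℚ) * (l * x + n * i - 1ℚ) + x * (n * m - (- l)) + (i - m * x) * (n - 0ℚ)
      lemma₃ = solve-∀ ℚ-ring
      n≢0 : n ≢ 0ℚ
      n≢0 n≡0 = 1≢0 (combine₃ (- 1ℚ) (z * i) (i - (i - i₀) * d * (z * i)) (on-line-xy on-line wi) nm n≡0
        (lemma₃ l (z * i) i n d ((i - i₀) * d)))

    add-equal : ∀ {i i₀} → OnCurve∞ z w → run z w z₀ w₀ ≢ 0ℚ → w * i ≡ 1ℚ → w₀ * i₀ ≡ 1ℚ → z₀ ≡ z → w₀ ≡ w → i₀ ≡ i →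
      Represents (add A (E (z₀ * i₀) i₀) (E (z * i) i)) z′ w′
    add-equal {i} {i₀} curve run≢0 wi w₀i₀ z₀≡z w₀≡w i₀≡i =
      subst (λ P → Represents P z′ w′) (trans (cong₂ (λ x y → third m x y (z * i)) x₀≡x i₀≡i)
          (trans (sym (add-tangent {m} {z * i} {i} i+i≢0 tangent)) (cong (λ P → add A P (E (z * i) i)) (sym (cong₂ E x₀≡x i₀≡i)))))
        (represents-third {m} n≢0 nm wi w₀i₀)
      where
      x₀≡x : z₀ * i₀ ≡ z * i
      x₀≡x = cong₂ _*_ z₀≡z i₀≡i
      w≢0 : w ≢ 0ℚ
      w≢0 = unit≢0 {w} {i} wi
      i≢0 : i ≢ 0ℚ
      i≢0 = unit≢0 {i} {w} (trans (*-comm i w) wi)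
      double : ∀ i → i + i ≡ 2ℚ * i
      double = lemma
        where
        lemma : ∀ i → i + i ≡ ℚ[ 2 ] * i
        lemma = solve-∀ ℚ-ring
      i+i≢0 : i + i ≢ 0ℚ
      i+i≢0 ii≡0 = i≢0 (*≡0⇒ {2ℚ} {i} (λ ()) (trans (sym (double i)) ii≡0))
      f = 3ℚ * (z * i) * (z * i) + 2ℚ * a * (z * i)
      d = proj₁ (inverse (i + i) i+i≢0)
      m = f * d
      lemma₁ : ∀ f d y → f * d * y - f ≡ f * (y * d - 1ℚ)
      lemma₁ = solve-∀ ℚ-ring
      tangent : m * (i + i) ≡ f
      tangent = combine₁ f (proj₂ (inverse (i + i) i+i≢0)) (lemma₁ f d (i + i))
      lemma₂ : ∀ l z n → l * z + n - l * z ≡ n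
      lemma₂ = solve-∀ ℚ-ring
      n≡w-lz : w - l * z ≡ n
      n≡w-lz = trans (cong (_- l * z) on-line) (lemma₂ l z n)
      nm : n * m ≡ - l
      nm = trans (cong (_* m) (sym n≡w-lz)) (tangent-slope {l} {z} {w} {i} {m} curve
        (subst₂ (λ u v → l * run z w u v ≡ rise z w u v) z₀≡z w₀≡w slope) wi
        (subst₂ (λ u v → run z w u v ≢ 0ℚ) z₀≡z w₀≡w run≢0) tangent)
      lemma₃ : ∀ l n m z w → w - 0ℚ ≡ 1ℚ * (w - (l * z + n)) + z * (n * m - (- l)) + (1ℚ - m * z) * (n - 0ℚ)
      lemma₃ = solve-∀ ℚ-ring
      n≢0 : n ≢ 0ℚ
      n≢0 n≡0 = w≢0 (combine₃ 1ℚ z (1ℚ - m * z) on-line nm n≡0 (lemma₃ l n m z w))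

    add-represents : ∀ {P Q} → OnCurve∞ z w → run z w z₀ w₀ ≢ 0ℚ → Represents P z w → Represents Q z₀ w₀ →
      Represents (add A Q P) z′ w′
    add-represents curve run≢0 (i , wi , refl) (i₀ , w₀i₀ , refl) with z₀ * i₀ ≟ z * i
    ... | no x₀≢x = add-distinct wi w₀i₀ x₀≢x
    ... | yes x₀≡x = add-equal curve run≢0 wi w₀i₀ z₀≡z w₀≡w i₀≡i
      where
      lemma₁ : ∀ z z₀ w i w₀ i₀ → z + z₀ - 0ℚ ≡ (- z) * (w * i - 1ℚ) + (- z₀) * (w₀ * i₀ - 1ℚ) + 1ℚ * (z * i * w + z₀ * i₀ * w₀ - 0ℚ)
      lemma₁ = solve-∀ ℚ-ring
      lemma₂ : ∀ w i w₀ i₀ → w + w₀ - 0ℚ ≡ (- w₀) * (w * i - 1ℚ) + (- w) * (w₀ * i₀ - 1ℚ) + w * w₀ * (i + i₀ - 0ℚ)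
      lemma₂ = solve-∀ ℚ-ring
      lemma₃ : ∀ x w w₀ → x * w + x * w₀ ≡ x * (w + w₀)
      lemma₃ = solve-∀ ℚ-ring
      lemma₄ : ∀ i i₀ → (i + i₀) * (i₀ - i) ≡ i₀ * i₀ - i * i
      lemma₄ = solve-∀ ℚ-ring
      lemma₅ : ∀ w i w₀ i₀ → w₀ - w ≡ (- w₀) * (w * i - 1ℚ) + w * (w₀ * i₀ - 1ℚ) + (- (w * w₀)) * (i₀ - i)
      lemma₅ = solve-∀ ℚ-ring
      lemma₆ : ∀ z w i → z * i * w - z ≡ z * (w * i - 1ℚ)
      lemma₆ = solve-∀ ℚ-ring
      not-opposite : i + i₀ ≢ 0ℚ
      not-opposite ii≡0 = z′≢0 (opposite⇒z′≡0
        (combine₃ (- z) (- z₀) 1ℚ wi w₀i₀ (trans (cong (λ x → z * i * w + x * w₀) x₀≡x)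
          (trans (lemma₃ (z * i) w w₀) (trans (cong (z * i *_) ww≡0) (*-zeroʳ (z * i))))) (lemma₁ z z₀ w i w₀ i₀))
        ww≡0)
        where
        ww≡0 : w + w₀ ≡ 0ℚ
        ww≡0 = combine₃ (- w₀) (- w) (w * w₀) wi w₀i₀ ii≡0 (lemma₂ w i w₀ i₀)
      i₀≡i : i₀ ≡ i
      i₀≡i = x-y≡0⇒x≡y (*≡0⇒ {i + i₀} not-opposite (trans (lemma₄ i i₀) (x≡y⇒x-y≡0
        (trans (curve-xy {z₀} {w₀} {i₀} curve₀ w₀i₀) (trans (cong (λ x → x * x * x + a * x * x + e) x₀≡x) (sym (curve-xy {z} {w} {i} curve wi)))))))
      w₀≡w : w₀ ≡ w
      w₀≡w = combine₃ (- w₀) w (- (w * w₀)) wi w₀i₀ i₀≡i (lemma₅ w i w₀ i₀)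
      z₀≡z : z₀ ≡ z
      z₀≡z = trans (sym (combine₁ z₀ w₀i₀ (lemma₆ z₀ w₀ i₀))) (trans (cong₂ _*_ x₀≡x w₀≡w) (combine₁ z wi (lemma₆ z w i)))

-- Multiples of a point in the kernel of reduction

-- The multiples of a point Q = (z₀ , w₀) in the kernel of reduction modulo N, that is, z₀ and w₀ / z₀
-- vanish modulo N. There translation by Q moves z by z₀ up to a relative error divisible by N.
module KernelOfReduction (N : ℕ) (1<N : 1 ℕ.< N) where
  open Localisation N 1<N

  module Translation {a e z₀ w₀ κ : ℚ} (a-loc : Local a) (e-loc : Local e)
    (L∣z₀ : L ∣ z₀) (L∣κ : L ∣ κ) (w₀≡z₀κ : w₀ ≡ z₀ * κ) (curve₀ : AtInfinity.OnCurve∞ a e z₀ w₀) where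
    open AtInfinity a e

    record State : Set where
      field
        z w : ℚ
        L∣z : L ∣ z
        L∣w : L ∣ w
        curve : OnCurve∞ z w

    private
      vanish⇒Local : ∀ {x} → L ∣ x → Local x
      vanish⇒Local = Local-∣ Local-L

      ∣-*ˡ : ∀ {d x y} → Local x → d ∣ y → d ∣ x * y
      ∣-*ˡ {d} {x} {y} x-loc d∣y = subst (d ∣_) (*-comm y x) (∣-*ʳ d∣y x-loc)

      L∣w₀ : L ∣ w₀
      L∣w₀ = subst (L ∣_) (sym w₀≡z₀κ) (∣-*ʳ L∣z₀ (vanish⇒Local L∣κ))

      inverse-1+ : ∀ {x} → L ∣ x → ∃ λ v → Local v × (1ℚ + x) * v ≡ 1ℚ
      inverse-1+ (divides r-loc refl) = unit-inverse r-loc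

      L∣rise : ∀ {z w z₁ w₁} → L ∣ z → L ∣ w → L ∣ z₁ → L ∣ w₁ → L ∣ rise z w z₁ w₁
      L∣rise z w z₁ w₁ = ∣-+ (∣-+ (∣-+ (∣-*ʳ z (vanish⇒Local z)) (∣-*ʳ z (vanish⇒Local z₁))) (∣-*ʳ z₁ (vanish⇒Local z₁)))
        (∣-*ʳ (∣-*ˡ a-loc w₁) (Local-+ (vanish⇒Local z) (vanish⇒Local z₁)))

      run-inverse : ∀ {z w z₁ w₁} → L ∣ z → L ∣ w → L ∣ z₁ → L ∣ w₁ → ∃ λ v → Local v × run z w z₁ w₁ * v ≡ 1ℚ
      run-inverse z w z₁ w₁ = inverse-1+ (∣-neg (∣-+ (∣-*ʳ (∣-*ˡ a-loc z) (vanish⇒Local z))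
        (∣-*ˡ e-loc (∣-+ (∣-+ (∣-*ʳ w (vanish⇒Local w)) (∣-*ʳ w (vanish⇒Local w₁))) (∣-*ʳ w₁ (vanish⇒Local w₁))))))

      Local-ℕ : ∀ n → Local ℚ[ n ]
      Local-ℕ n = Local-int (Integral-ℕ n)

      c₃-inverse : ∀ {l} → L ∣ l → ∃ λ u → Local u × c₃ l * u ≡ 1ℚ
      c₃-inverse {l} L∣l =
        let u , u-loc , eq = inverse-1+ (∣-+ (∣-*ˡ a-loc L∣l) (∣-*ʳ (∣-*ʳ (∣-*ˡ e-loc L∣l) (vanish⇒Local L∣l)) (vanish⇒Local L∣l)))
        in u , u-loc , trans (cong (_* u) (+-assoc 1ℚ (a * l) (e * l * l * l))) eq

      slope-equation : ∀ {r q v} → r * v ≡ 1ℚ → q * v * r ≡ q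
      slope-equation {r} {q} {v} rv = combine₁ q rv (lemma r q v)
        where
        lemma : ∀ r q v → q * v * r - q ≡ q * (r * v - 1ℚ)
        lemma = solve-∀ ℚ-ring

      offset : ∀ {w w₁ l z z₁} → w - w₁ ≡ l * (z - z₁) → w ≡ l * z + (w₁ - l * z₁)
      offset {w} {w₁} {l} {z} {z₁} eq = combine₁ 1ℚ eq (lemma w w₁ l z z₁)
        where
        lemma : ∀ w w₁ l z z₁ → w - (l * z + (w₁ - l * z₁)) ≡ 1ℚ * (w - w₁ - l * (z - z₁))
        lemma = solve-∀ ℚ-ring

    w-lipschitz : ∀ S T → let open State in z S - z T ∣ w S - w T
    w-lipschitz S T =
      let v , v-loc , rv = run-inverse S.L∣z S.L∣w T.L∣z T.L∣w
          l = rise S.z S.w T.z T.w * v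
      in divides (Local-* (vanish⇒Local (L∣rise S.L∣z S.L∣w T.L∣z T.L∣w)) v-loc)
          (trans (line-through l S.curve T.curve (unit≢0 rv) (slope-equation rv)) (*-comm l _))
      where
      module S = State S
      module T = State T

    record Step (S S′ : State) : Set where
      module S = State S
      module S′ = State S′
      field
        l v u : ℚ
        L∣l : L ∣ l
        v-loc : Local v
        u-loc : Local u
        run-v : run S.z S.w z₀ w₀ * v ≡ 1ℚ
        l≡ : l ≡ rise S.z S.w z₀ w₀ * v
        c₃-u : c₃ l * u ≡ 1ℚ
        on-line : S.w ≡ l * S.z + (w₀ - l * z₀)
        z′≡ : S′.z ≡ S.z + z₀ + c₂ l (w₀ - l * z₀) * u
        w′≡ : S′.w ≡ l * S′.z - (w₀ - l * z₀)

      slope : l * run S.z S.w z₀ w₀ ≡ rise S.z S.w z₀ w₀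
      slope = trans (cong (_* run S.z S.w z₀ w₀) l≡) (slope-equation run-v)

    private
      third-sum : ∀ z c₂ u c₃ → c₃ * u ≡ 1ℚ → c₃ * (z + z₀ + c₂ * u - z - z₀) ≡ c₂
      third-sum z c₂ u c₃ eq = combine₁ c₂ eq (lemma z z₀ c₂ u c₃)
        where
        lemma : ∀ z z₀ c₂ u c₃ → c₃ * (z + z₀ + c₂ * u - z - z₀) - c₂ ≡ c₂ * (c₃ * u - 1ℚ)
        lemma = solve-∀ ℚ-ring

    private
      line₀ : ∀ w₀ l z₀ → w₀ ≡ l * z₀ + (w₀ - l * z₀)
      line₀ = solve-∀ ℚ-ring

      build-step : ∀ S {l v u z′} → let open State S in L ∣ l → Local v → Local u → run z w z₀ w₀ * v ≡ 1ℚ →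
        l ≡ rise z w z₀ w₀ * v → c₃ l * u ≡ 1ℚ → z′ ≡ z + z₀ + c₂ l (w₀ - l * z₀) * u → ∃ λ S′ → Step S S′
      build-step S {l} {v} {u} {z′} L∣l v-loc u-loc run-v l≡ c₃-u z′≡ =
        record { z = z′ ; w = l * z′ - (w₀ - l * z₀) ; L∣z = L∣z′ ; L∣w = ∣-- (∣-*ʳ L∣l (vanish⇒Local L∣z′)) L∣n ; curve = reflected-on-curve meet } ,
        record
          { l = l ; v = v ; u = u ; L∣l = L∣l ; v-loc = v-loc ; u-loc = u-loc ; run-v = run-v ; l≡ = l≡ ; c₃-u = c₃-u
          ; on-line = on-line ; z′≡ = z′≡ ; w′≡ = refl }
        where
        open State S
        slope : l * run z w z₀ w₀ ≡ rise z w z₀ w₀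
        slope = trans (cong (_* run z w z₀ w₀) l≡) (slope-equation run-v)
        L∣n : L ∣ w₀ - l * z₀
        L∣n = ∣-- L∣w₀ (∣-*ʳ L∣l (vanish⇒Local L∣z₀))
        on-line : w ≡ l * z + (w₀ - l * z₀)
        on-line = offset {w} {w₀} {l} {z} {z₀} (line-through {z} {w} {z₀} {w₀} l curve curve₀ (unit≢0 run-v) slope)
        L∣z′ : L ∣ z′
        L∣z′ = subst (L ∣_) (sym z′≡) (∣-+ (∣-+ L∣z L∣z₀) (∣-*ʳ (∣-*ʳ L∣n (Local-+ a-loc
          (Local-* (Local-* (Local-* (Local-ℕ 3) e-loc) (vanish⇒Local L∣l)) (vanish⇒Local L∣l)))) u-loc))
        meet : Intersection l (w₀ - l * z₀) z z₀ z′
        meet = intersection on-line (line₀ w₀ l z₀) curve₀ slope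
          (trans (cong (λ x → c₃ l * (x - z - z₀)) z′≡) (third-sum z (c₂ l (w₀ - l * z₀)) u (c₃ l) c₃-u))

    opaque
      translate : ∀ S → ∃ λ S′ → Step S S′
      translate S =
        let open State S
            v , v-loc , run-v = run-inverse L∣z L∣w L∣z₀ L∣w₀
            L∣l = ∣-*ʳ (L∣rise L∣z L∣w L∣z₀ L∣w₀) v-loc
            u , u-loc , c₃-u = c₃-inverse L∣l
        in build-step S L∣l v-loc u-loc run-v refl c₃-u refl

    translate-z : ∀ {S S′} (step : Step S S′) →
      let open State S
          open Step step using (l; u)
      in z + z₀ + (z₀ * κ - l * z₀) * (a + 3ℚ * e * l * l) * u ≡ State.z S′
    translate-z {S} step = trans (cong (λ x → z + z₀ + (x - l * z₀) * (a + 3ℚ * e * l * l) * u) (sym w₀≡z₀κ)) (sym (Step.z′≡ step))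
      where
      open State S
      open Step step using (l; u)

    private
      ∣-quotient : ∀ {d x₁ x₂ y₁ y₂ v₁ v₂} → y₁ * v₁ ≡ 1ℚ → y₂ * v₂ ≡ 1ℚ → Local x₂ → Local v₁ → Local v₂ →
        d ∣ x₁ - x₂ → d ∣ y₁ - y₂ → d ∣ x₁ * v₁ - x₂ * v₂
      ∣-quotient {d} {x₁} {x₂} {y₁} {y₂} {v₁} {v₂} yv₁ yv₂ x₂-loc v₁-loc v₂-loc d∣x d∣y = subst (d ∣_)
          (combine₂ (- (x₂ * v₂)) (x₂ * v₁) yv₁ yv₂ (lemma x₁ x₂ y₁ y₂ v₁ v₂))
          (∣-- (∣-*ʳ d∣x v₁-loc) (∣-*ʳ (∣-*ʳ (∣-*ˡ x₂-loc d∣y) v₁-loc) v₂-loc))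
        where
        lemma : ∀ x₁ x₂ y₁ y₂ v₁ v₂ → (x₁ - x₂) * v₁ - x₂ * (y₁ - y₂) * v₁ * v₂ - (x₁ * v₁ - x₂ * v₂)
          ≡ (- (x₂ * v₂)) * (y₁ * v₁ - 1ℚ) + x₂ * v₁ * (y₂ * v₂ - 1ℚ)
        lemma = solve-∀ ℚ-ring

    module _ {S S′ T T′ : State} (step : Step S S′) (step′ : Step T T′) where
      private
        module S = State S
        module T = State T
        module P = Step step
        module P′ = Step step′
        d = S.z - T.z

        rise-lipschitz : d * L ∣ rise S.z S.w z₀ w₀ - rise T.z T.w z₀ w₀
        rise-lipschitz = subst (d * L ∣_) (lemma S.z T.z z₀ w₀ a)
          (∣-* (∣-refl {d}) (∣-+ (∣-+ (∣-+ S.L∣z T.L∣z) L∣z₀) (∣-*ˡ a-loc L∣w₀)))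
          where
          lemma : ∀ z z′ z₀ w₀ a → (z - z′) * (z + z′ + z₀ + a * w₀)
            ≡ (z * z + z * z₀ + z₀ * z₀ + a * w₀ * (z + z₀)) - (z′ * z′ + z′ * z₀ + z₀ * z₀ + a * w₀ * (z′ + z₀))
          lemma = solve-∀ ℚ-ring

        run-lipschitz : d * L ∣ run S.z S.w z₀ w₀ - run T.z T.w z₀ w₀
        run-lipschitz = subst (d * L ∣_) (lemma S.z T.z S.w T.w w₀ a e)
          (∣-neg (∣-+ (∣-*ˡ a-loc (∣-* (∣-refl {d}) (∣-+ S.L∣z T.L∣z)))
            (∣-*ˡ e-loc (∣-* (w-lipschitz S T) (∣-+ (∣-+ S.L∣w T.L∣w) L∣w₀)))))
          where
          lemma : ∀ z z′ w w′ w₀ a e → - (a * ((z - z′) * (z + z′)) + e * ((w - w′) * (w + w′ + w₀)))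
            ≡ (1ℚ + (- (a * z * z + e * (w * w + w * w₀ + w₀ * w₀)))) - (1ℚ + (- (a * z′ * z′ + e * (w′ * w′ + w′ * w₀ + w₀ * w₀))))
          lemma = solve-∀ ℚ-ring

        slope-lipschitz : d * L ∣ P.l - P′.l
        slope-lipschitz = subst₂ (λ x y → d * L ∣ x - y) (sym P.l≡) (sym P′.l≡)
          (∣-quotient {d * L} {rise S.z S.w z₀ w₀} {rise T.z T.w z₀ w₀} {run S.z S.w z₀ w₀} {run T.z T.w z₀ w₀} {P.v} {P′.v} P.run-v P′.run-v (vanish⇒Local (L∣rise T.L∣z T.L∣w L∣z₀ L∣w₀)) P.v-loc P′.v-loc rise-lipschitz run-lipschitz)

        g : ℚ → ℚ
        g l = (κ - l) * (a + 3ℚ * e * l * l)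

        κ-loc = vanish⇒Local L∣κ
        l-loc = vanish⇒Local P.L∣l
        l′-loc = vanish⇒Local P′.L∣l

        g-loc : ∀ {l} → Local l → Local (g l)
        g-loc l-loc = Local-* (Local-- κ-loc l-loc) (Local-+ a-loc (Local-* (Local-* (Local-* (Local-ℕ 3) e-loc) l-loc) l-loc))

        squares-loc : Local (P.l * P.l + P.l * P′.l + P′.l * P′.l)
        squares-loc = Local-+ (Local-+ (Local-* l-loc l-loc) (Local-* l-loc l′-loc)) (Local-* l′-loc l′-loc)

        g-lipschitz : d * L ∣ g P.l - g P′.l
        g-lipschitz = subst (d * L ∣_) (lemma P.l P′.l κ a e)
          (∣-*ʳ slope-lipschitz (Local-- (Local-- (Local-* (Local-* (Local-* (Local-ℕ 3) κ-loc) e-loc) (Local-+ l-loc l′-loc)) a-loc)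
            (Local-* (Local-* (Local-ℕ 3) e-loc) squares-loc)))
          where
          lemma : ∀ l l′ κ a e → (l - l′) * (ℚ[ 3 ] * κ * e * (l + l′) - a - ℚ[ 3 ] * e * (l * l + l * l′ + l′ * l′))
            ≡ (κ - l) * (a + ℚ[ 3 ] * e * l * l) - (κ - l′) * (a + ℚ[ 3 ] * e * l′ * l′)
          lemma = solve-∀ ℚ-ring

        c₃-lipschitz : d * L ∣ c₃ P.l - c₃ P′.l
        c₃-lipschitz = subst (d * L ∣_) (lemma P.l P′.l a e)
          (∣-*ʳ slope-lipschitz (Local-+ a-loc (Local-* e-loc squares-loc)))
          where
          lemma : ∀ l l′ a e → (l - l′) * (a + e * (l * l + l * l′ + l′ * l′))
            ≡ (1ℚ + a * l + e * l * l * l) - (1ℚ + a * l′ + e * l′ * l′ * l′)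
          lemma = solve-∀ ℚ-ring

      translate-lipschitz : d * (L * L) ∣ (State.z S′ - S.z) - (State.z T′ - T.z)
      translate-lipschitz = subst₂ _∣_ (lemma₁ d L)
          (trans (lemma₂ S.z T.z z₀ κ P.l P′.l P.u P′.u (a + 3ℚ * e * P.l * P.l) (a + 3ℚ * e * P′.l * P′.l))
            (cong₂ (λ x y → (x - S.z) - (y - T.z)) (translate-z step) (translate-z step′)))
          (∣-* L∣z₀ (∣-quotient {d * L} {g P.l} {g P′.l} {c₃ P.l} {c₃ P′.l} {P.u} {P′.u} P.c₃-u P′.c₃-u (g-loc l′-loc) P.u-loc P′.u-loc g-lipschitz c₃-lipschitz))
        where
        lemma₁ : ∀ d L → L * (d * L) ≡ d * (L * L)
        lemma₁ = solve-∀ ℚ-ring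
        lemma₂ : ∀ z z′ z₀ κ l l′ u u′ k k′ → z₀ * ((κ - l) * k * u - (κ - l′) * k′ * u′)
          ≡ (z + z₀ + (z₀ * κ - l * z₀) * k * u - z) - (z′ + z₀ + (z₀ * κ - l′ * z₀) * k′ * u′ - z′)
        lemma₂ = solve-∀ ℚ-ring

    translate-increment : ∀ {S S′} → Step S S′ → z₀ * L ∣ State.z S′ - State.z S - z₀
    translate-increment {S} {S′} step = subst (z₀ * L ∣_)
        (trans (lemma z z₀ κ l u (a + 3ℚ * e * l * l)) (cong (λ x → x - z - z₀) (translate-z step)))
        (∣-* (∣-refl {z₀}) (∣-*ʳ (∣-*ʳ (∣-- L∣κ L∣l) (Local-+ a-loc (Local-* (Local-* (Local-* (Local-ℕ 3) e-loc) l-loc) l-loc))) u-loc))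
      where
      open State S using (z)
      open Step step using (l; u; L∣l; u-loc)
      l-loc = vanish⇒Local L∣l
      lemma : ∀ z z₀ κ l u k → z₀ * ((κ - l) * k * u) ≡ z + z₀ + (z₀ * κ - l * z₀) * k * u - z - z₀
      lemma = solve-∀ ℚ-ring

    origin : State
    origin = record { z = 0ℚ ; w = 0ℚ ; L∣z = divides Local-0 (sym (*-zeroʳ L)) ; L∣w = divides Local-0 (sym (*-zeroʳ L)) ; curve = lemma a e }
      where
      lemma : ∀ a e → 0ℚ ≡ 0ℚ * 0ℚ * 0ℚ + a * 0ℚ * 0ℚ * 0ℚ + e * 0ℚ * 0ℚ * 0ℚ
      lemma = solve-∀ ℚ-ring

    orbit : ℕ → State
    orbit zero = origin
    orbit (suc n) = proj₁ (translate (orbit n))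

    orbit-step : ∀ n → Step (orbit n) (orbit (suc n))
    orbit-step n = proj₂ (translate (orbit n))

    orbit-drift : Drift (λ n → State.z (orbit n)) z₀
    orbit-drift = record
      { increment = λ i → translate-increment (orbit-step i)
      ; lipschitz = λ i j → translate-lipschitz (orbit-step i) (orbit-step j)
      }

    orbit-z≢0 : z₀ ≢ 0ℚ → ∀ n → State.z (orbit (suc n)) ≢ 0ℚ
    orbit-z≢0 z₀≢0 n = no-return (suc n) (λ n → State.z (orbit n)) z₀ z₀≢0 orbit-drift (λ ())

    module _ {A s μ i₀ : ℚ} (μ≢0 : μ ≢ 0ℚ) (μμa≡-3s : μ * μ * a ≡ - (3ℚ * s)) (A≡-3ss : A ≡ - (3ℚ * s * s))
        (z₀≢0 : z₀ ≢ 0ℚ) (w₀i₀ : w₀ * i₀ ≡ 1ℚ) where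
      open Model A a s μ μ≢0 μμa≡-3s A≡-3ss
      open Addition A a s μ μ≢0 μμa≡-3s A≡-3ss e

      private
        Q : Point
        Q = E (z₀ * i₀) i₀

        first : ∀ {S} → Step origin S → State.z S ≡ z₀ × State.w S ≡ w₀
        first {S} step = z≡z₀ , trans w′≡ (trans (cong (λ x → l * x - (w₀ - l * z₀)) z≡z₀) (combine₁ (- 2ℚ) n≡0 (lemma₃ l z₀ w₀)))
          where
          open Step step using (l; u; on-line; z′≡; w′≡)
          lemma₁ : ∀ l n → l * 0ℚ + n ≡ n
          lemma₁ = solve-∀ ℚ-ring
          lemma₂ : ∀ z₀ k u → 0ℚ + z₀ + 0ℚ * k * u ≡ z₀
          lemma₂ = solve-∀ ℚ-ring
          lemma₃ : ∀ l z₀ w₀ → l * z₀ - (w₀ - l * z₀) - w₀ ≡ (- ℚ[ 2 ]) * (w₀ - l * z₀ - 0ℚ)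
          lemma₃ = solve-∀ ℚ-ring
          n≡0 : w₀ - l * z₀ ≡ 0ℚ
          n≡0 = trans (sym (lemma₁ l (w₀ - l * z₀))) (sym on-line)
          z≡z₀ : State.z S ≡ z₀
          z≡z₀ = trans z′≡ (trans (cong (λ n → 0ℚ + z₀ + n * (a + 3ℚ * e * l * l) * u) n≡0) (lemma₂ z₀ (a + 3ℚ * e * l * l) u))

        represents-next : ∀ {P S S′} → Step S S′ → State.z S′ ≢ 0ℚ → Represents P (State.z S) (State.w S) →
          Represents (add A Q P) (State.z S′) (State.w S′)
        represents-next {P} {S} {S′} step z′≢0 rep = subst (Represents (add A Q P) (State.z S′)) (sym w′≡)
          (add-represents on-line (line₀ w₀ l z₀) curve₀ slope
            (trans (cong (λ x → c₃ l * (x - z - z₀)) z′≡) (third-sum z (c₂ l (w₀ - l * z₀)) u (c₃ l) c₃-u))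
            (unit≢0 c₃-u) z′≢0 curve (unit≢0 run-v) rep (i₀ , w₀i₀ , refl))
          where
          open State S using (z; curve)
          open Step step using (l; u; on-line; slope; z′≡; w′≡; c₃-u; run-v)

        multiples : ∀ n → Represents (mul A (suc n) Q) (State.z (orbit (suc n))) (State.w (orbit (suc n)))
        multiples zero =
          let z≡z₀ , w≡w₀ = first (orbit-step 0)
          in subst₂ (Represents Q) (sym z≡z₀) (sym w≡w₀) (i₀ , w₀i₀ , refl)
        multiples (suc n) = represents-next (orbit-step (suc n)) (orbit-z≢0 z₀≢0 (suc n)) (multiples n)

        represents⇒≢O : ∀ {P z w} → Represents P z w → P ≢ O
        represents⇒≢O (_ , _ , refl) ()

      infinite-order : InfiniteOrder A (E (z₀ * i₀) i₀)
      infinite-order n = represents⇒≢O {mul A (suc n) Q} {State.z (orbit (suc n))} {State.w (orbit (suc n))} (multiples n)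

-- Positive rank

-- The curve E₄ is y² = x³ − p q x² + (p − q)² q⁴ with p / q = 3 a c / b², via X = (a b / q)² x − a³ c, Y = (a b / q)³ y.
module Rescaled {a b c p q : ℚ} (a≢0 : a ≢ 0ℚ) (b≢0 : b ≢ 0ℚ) (q≢0 : q ≢ 0ℚ) (ratio : 3ℚ * a * c * q ≡ b * b * p) where

  q⁻¹ μ s a₂ a₆ : ℚ
  q⁻¹ = proj₁ (inverse q q≢0)
  μ = a * b * q⁻¹
  s = a * a * a * c
  a₂ = - (p * q)
  a₆ = (p - q) * (p - q) * (q * q * q * q)

  qq⁻¹ : q * q⁻¹ ≡ 1ℚ
  qq⁻¹ = proj₂ (inverse q q≢0)

  μ≢0 : μ ≢ 0ℚ
  μ≢0 = *-≢0 {a * b} {q⁻¹} (*-≢0 {a} {b} a≢0 b≢0) (unit≢0 {q⁻¹} {q} (trans (*-comm q⁻¹ q) qq⁻¹))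

  μμa₂≡-3s : μ * μ * a₂ ≡ - (3ℚ * s)
  μμa₂≡-3s = combine₂ (a * a * q⁻¹) (- (a * a * (b * b * p * q⁻¹ + ℚ[ 3 ] * a * c))) ratio qq⁻¹ (lemma a b c p q q⁻¹)
    where
    lemma : ∀ a b c p q i → (a * b * i) * (a * b * i) * (- (p * q)) - (- (ℚ[ 3 ] * (a * a * a * c)))
      ≡ a * a * i * (ℚ[ 3 ] * a * c * q - b * b * p) + (- (a * a * (b * b * p * i + ℚ[ 3 ] * a * c))) * (q * i - 1ℚ)
    lemma = solve-∀ ℚ-ring

  A≡-3ss : E₄-A a b c ≡ - (3ℚ * s * s)
  A≡-3ss = lemma a c
    where
    lemma : ∀ a c → - (ℚ[ 3 ] * (a * a * a * a * a * a) * c * c) ≡ - (ℚ[ 3 ] * (a * a * a * c) * (a * a * a * c))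
    lemma = solve-∀ ℚ-ring

  open Model (E₄-A a b c) a₂ s μ μ≢0 μμa₂≡-3s A≡-3ss public using (E)

  μμμ[p-q]qq : μ * μ * μ * ((p - q) * (q * q)) ≡ a * a * a * b * (3ℚ * a * c - b * b)
  μμμ[p-q]qq = combine₂ (- (a * a * a * b * q⁻¹ * (q * q⁻¹) * (q * q⁻¹)))
      (a * a * a * b * (3ℚ * a * c - b * b) * ((q * q⁻¹) * (q * q⁻¹) + q * q⁻¹ + 1ℚ)) ratio qq⁻¹ (lemma a b c p q q⁻¹)
    where
    lemma : ∀ a b c p q i → (a * b * i) * (a * b * i) * (a * b * i) * ((p - q) * (q * q)) - a * a * a * b * (ℚ[ 3 ] * a * c - b * b)
      ≡ (- (a * a * a * b * i * (q * i) * (q * i))) * (ℚ[ 3 ] * a * c * q - b * b * p)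
        + a * a * a * b * (ℚ[ 3 ] * a * c - b * b) * ((q * i) * (q * i) + q * i + 1ℚ) * (q * i - 1ℚ)
    lemma = solve-∀ ℚ-ring

  μ⁶a₆-2s³ : (μ * μ * μ) * (μ * μ * μ) * a₆ - 2ℚ * s * s * s ≡ E₄-B a b c
  μ⁶a₆-2s³ = trans (cong (λ k → k - 2ℚ * s * s * s) (trans (lemma₁ (μ * μ * μ) p q) (cong (λ k → k * k) μμμ[p-q]qq))) (lemma₂ a b c)
    where
    lemma₁ : ∀ k p q → k * k * ((p - q) * (p - q) * (q * q * q * q)) ≡ (k * ((p - q) * (q * q))) * (k * ((p - q) * (q * q)))
    lemma₁ = solve-∀ ℚ-ring
    lemma₂ : ∀ a b c → let k = a * a * a * b * (ℚ[ 3 ] * a * c - b * b); s = a * a * a * c in k * k - ℚ[ 2 ] * s * s * s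
      ≡ - ((a * a * a * a * a * a) * (ℚ[ 2 ] * a * c - b * b) * (a * a * c * c - ℚ[ 4 ] * a * b * b * c + b * b * b * b))
    lemma₂ = solve-∀ ℚ-ring

  E-on-curve : ∀ {x y} → y * y ≡ x * x * x + a₂ * x * x + a₆ → OnCurve (E₄-A a b c) (E₄-B a b c) (E x y)
  E-on-curve {x} {y} curve = combine₃ (k * k) (μ * μ * μ * μ * x * x) 1ℚ curve μμa₂≡-3s μ⁶a₆-2s³
      (trans (cong (λ A → k * y * (k * y) - (X * X * X + A * X + E₄-B a b c)) A≡-3ss) (lemma x y μ a₂ s a₆ (E₄-B a b c)))
    where
    k = μ * μ * μ
    X = μ * μ * x - s
    lemma : ∀ x y μ a s e B → let k = μ * μ * μ; X = μ * μ * x - s in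
      k * y * (k * y) - (X * X * X + (- (ℚ[ 3 ] * s * s)) * X + B)
        ≡ k * k * (y * y - (x * x * x + a * x * x + e)) + μ * μ * μ * μ * x * x * (μ * μ * a - (- (ℚ[ 3 ] * s)))
          + 1ℚ * (k * k * e - ℚ[ 2 ] * s * s * s - B)
    lemma = solve-∀ ℚ-ring

  positive-rank-criterion : Integral p → Integral q → ∀ N (1<N : 1 ℕ.< N) → let open Localisation N 1<N in
    ∀ {x y κ z} → x * κ ≡ 1ℚ → z * y ≡ x → L ∣ z → L ∣ κ → y * y ≡ x * x * x + a₂ * x * x + a₆ →
    PositiveRank (E₄-A a b c) (E₄-B a b c)
  positive-rank-criterion p-int q-int N 1<N {x} {y} {κ} {z} xκ zy L∣z L∣κ curve =
      E x y , E-on-curve curve ,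
      subst (λ x → InfiniteOrder (E₄-A a b c) (E x y)) zy
        (infinite-order {E₄-A a b c} {s} {μ} {y} μ≢0 μμa₂≡-3s A≡-3ss z≢0 wy)
    where
    open Localisation N 1<N
    open AtInfinity a₂ a₆
    w = z * κ
    wy : w * y ≡ 1ℚ
    wy = trans (lemma z κ y) (trans (cong (_* κ) zy) xκ)
      where
      lemma : ∀ z κ y → z * κ * y ≡ z * y * κ
      lemma = solve-∀ ℚ-ring
    z≡xw : z ≡ x * w
    z≡xw = combine₁ (- z) xκ (lemma x κ z)
      where
      lemma : ∀ x κ z → z - x * (z * κ) ≡ (- z) * (x * κ - 1ℚ)
      lemma = solve-∀ ℚ-ring
    z≢0 : z ≢ 0ℚ
    z≢0 z≡0 = unit≢0 {x} {κ} xκ (trans (sym zy) (trans (cong (_* y) z≡0) (*-zeroˡ y)))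
    curve∞ : OnCurve∞ z w
    curve∞ = subst (λ z → OnCurve∞ z w) (sym z≡xw) (combine₂ (w * w * w) (- (w * (w * y + 1ℚ))) curve wy (lemma x y w a₂ a₆))
      where
      lemma : ∀ x y w a e → w - (x * w * (x * w) * (x * w) + a * (x * w) * (x * w) * w + e * w * w * w)
        ≡ w * w * w * (y * y - (x * x * x + a * x * x + e)) + (- (w * (w * y + 1ℚ))) * (w * y - 1ℚ)
      lemma = solve-∀ ℚ-ring
    a₂-int : Integral a₂
    a₂-int = Integral-neg (Integral-* p-int q-int)
    p-q-int : Integral (p - q)
    p-q-int = Integral-+ p-int (Integral-neg q-int)
    a₆-int : Integral a₆
    a₆-int = Integral-* (Integral-* p-q-int p-q-int) (Integral-* (Integral-* (Integral-* q-int q-int) q-int) q-int)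
    open KernelOfReduction.Translation N 1<N {a₂} {a₆} {z} {w} {κ} (Local-int a₂-int) (Local-int a₆-int) L∣z L∣κ refl curve∞

module Units (N : ℕ) (1<N : 1 ℕ.< N) where
  open Localisation N 1<N

  record Unit (x : ℚ) : Set where
    constructor unit
    field
      {x⁻¹} : ℚ
      x⁻¹-local : Local x⁻¹
      inverseʳ : x * x⁻¹ ≡ 1ℚ

  opaque
    Unit-* : ∀ {x y} → Unit x → Unit y → Unit (x * y)
    Unit-* {x} {y} (unit {v} v-loc xv) (unit {u} u-loc yu) = unit (Local-* v-loc u-loc)
      (trans (lemma x y v u) (cong₂ _*_ xv yu))
      where
      lemma : ∀ x y v u → x * y * (v * u) ≡ (x * v) * (y * u)
      lemma = solve-∀ ℚ-ring

    Unit-by : ∀ {x m y} → Local m → L ∣ y → x * m ≡ 1ℚ + y → Unit x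
    Unit-by {x} {m} {y} m-loc (divides {r} r-loc refl) xm with v , v-loc , eq ← unit-inverse r-loc =
      unit (Local-* m-loc v-loc) (trans (sym (*-assoc x m v)) (trans (cong (_* v) xm) eq))

    Unit-+ : ∀ {x y} → Unit x → L ∣ y → Unit (x + y)
    Unit-+ {x} {y} (unit {v} v-loc xv) L∣y = Unit-by v-loc (∣-*ʳ L∣y v-loc)
      (trans (*-distribʳ-+ v x y) (cong (_+ y * v) xv))

module _ {a b c p q : ℚ} (a≢0 : a ≢ 0ℚ) (b≢0 : b ≢ 0ℚ) (q≢0 : q ≢ 0ℚ) (ratio : 3ℚ * a * c * q ≡ b * b * p)
    (p-int : Integral p) (q-int : Integral q) where
  open Rescaled {a} {b} {c} {p} {q} a≢0 b≢0 q≢0 ratio using (positive-rank-criterion)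

  private
    d : ℚ
    d = p - q

    d-int : Integral d
    d-int = Integral-+ p-int (Integral-neg q-int)

  -- The point is three times (0 , (p − q) q²).
  third-multiple : ∀ N (1<N : 1 ℕ.< N) →
    let open Localisation N 1<N
        open Units N 1<N
    in ∀ {j r} → Integral j → Integral r → j * r ≡ 2ℚ → p ≡ j * L → Unit r → Unit q → PositiveRank (E₄-A a b c) (E₄-B a b c)
  third-multiple N 1<N {j} {r} j-int r-int jr p≡jL r-unit q-unit =
    positive-rank-criterion p-int q-int N 1<N {x} {y} {κ} {z} xκ zy L∣z L∣κ curve
    where
    open Localisation N 1<N
    open Units N 1<N
    t = proj₁ (inverse L L≢0)
    Lt : L * t ≡ 1ℚ
    Lt = proj₂ (inverse L L≢0)
    D₀ = (r * r) * ((d * d) * (q * q))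
    g = (r * r * r) * (q * (d * d)) + (- (L * L * L))
    L∣p : L ∣ p
    L∣p = subst (L ∣_) (trans (*-comm L j) (sym p≡jL)) (∣-*ʳ (∣-refl {L}) (Local-int j-int))
    -1-unit : Unit (- 1ℚ)
    -1-unit = unit {x⁻¹ = - 1ℚ} (Local-neg Local-1) refl
    d-unit : Unit d
    d-unit = subst Unit (lemma p q) (Unit-+ (Unit-* -1-unit q-unit) L∣p)
      where
      lemma : ∀ p q → (- 1ℚ) * q + p ≡ p - q
      lemma = solve-∀ ℚ-ring
    D₀-unit : Unit D₀
    D₀-unit = Unit-* (Unit-* r-unit r-unit) (Unit-* (Unit-* d-unit d-unit) (Unit-* q-unit q-unit))
    v = Unit.x⁻¹ D₀-unit
    vv : D₀ * v ≡ 1ℚ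
    vv = Unit.inverseʳ D₀-unit
    g-unit : Unit g
    g-unit = Unit-+ (Unit-* (Unit-* (Unit-* r-unit r-unit) r-unit) (Unit-* q-unit (Unit-* d-unit d-unit)))
      (∣-neg (∣-*ʳ (∣-*ʳ ∣-refl Local-L) Local-L))
    u = Unit.x⁻¹ g-unit
    uu : g * u ≡ 1ℚ
    uu = Unit.inverseʳ g-unit
    x = D₀ * (t * t)
    y = d * (q * q) * ((r * r * r) * (q * (d * d)) * (t * t * t) - 1ℚ)
    κ = L * L * v
    z = L * ((r * r) * d * u)
    lemma₁ : ∀ D t L v → D * (t * t) * (L * L * v) - 1ℚ ≡ (L * t) * (L * t) * (D * v - 1ℚ) + (L * t + 1ℚ) * (L * t - 1ℚ)
    lemma₁ = solve-∀ ℚ-ring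
    xκ : x * κ ≡ 1ℚ
    xκ = combine₂ ((L * t) * (L * t)) (L * t + 1ℚ) vv Lt (lemma₁ D₀ t L v)
    lemma₂ : ∀ r d q t L u → let k = (r * r * r) * (q * (d * d)); D = r * r * (d * d * (q * q)) in
      L * ((r * r) * d * u) * (d * (q * q) * (k * (t * t * t) - 1ℚ)) - D * (t * t)
        ≡ L * t * (D * (t * t)) * ((k + (- (L * L * L))) * u - 1ℚ)
          + (D * u * L * ((L * t) * (L * t) + L * t + 1ℚ) + D * (t * t)) * (L * t - 1ℚ)
    lemma₂ = solve-∀ ℚ-ring
    zy : z * y ≡ x
    zy = combine₂ (L * t * (D₀ * (t * t))) (D₀ * u * L * ((L * t) * (L * t) + L * t + 1ℚ) + D₀ * (t * t)) uu Lt (lemma₂ r d q t L u)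
    L∣z : L ∣ z
    L∣z = ∣-*ʳ (∣-refl {L}) (Local-* (Local-* (Local-* (Local-int r-int) (Local-int r-int)) (Local-int d-int)) (Unit.x⁻¹-local g-unit))
    L∣κ : L ∣ κ
    L∣κ = ∣-*ʳ (∣-*ʳ (∣-refl {L}) Local-L) (Unit.x⁻¹-local D₀-unit)
    lemma₃ : ∀ p t j L → p * t - j ≡ t * (p - j * L) + j * (L * t - 1ℚ)
    lemma₃ = solve-∀ ℚ-ring
    p*t≡j : p * t ≡ j
    p*t≡j = combine₂ t j p≡jL Lt (lemma₃ p t j L)
    lemma₄ : ∀ p q d r j t → let x = r * r * (d * d * (q * q)) * (t * t); k = d * d * (q * q * q * q) * (q * (r * r * r) * (d * d) * (t * t * t))
                                 y = d * (q * q) * ((r * r * r) * (q * (d * d)) * (t * t * t) - 1ℚ) in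
      y * y - (x * x * x + (- (p * q)) * x * x + d * d * (q * q * q * q)) ≡ k * r * (p * t - j) + k * (j * r - ℚ[ 2 ])
    lemma₄ = solve-∀ ℚ-ring
    curve : y * y ≡ x * x * x + (- (p * q)) * x * x + d * d * (q * q * q * q)
    curve = combine₂ (k * r) k p*t≡j jr (lemma₄ p q d r j t)
      where k = d * d * (q * q * q * q) * (q * (r * r * r) * (d * d) * (t * t * t))

  -- The point is four times (0 , (p − q) q²); only p = 1 and p = 2 occur.
  fourth-multiple : ∀ N (1<N : 1 ℕ.< N) →
    let open Localisation N 1<N
        open Units N 1<N
    in ∀ {r l f g} → Integral r → l ≢ 0ℚ → L ∣ l → Unit p →
    f ≡ p * p + l * (- (2ℚ * q * d)) → g ≡ p * p * p + l * (r * r * q * q * d * d * d - ℚ[ 4 ] * p * q * d) →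
    g * g ≡ f * f * f - p * q * f * f * (l * l) + d * d * (q * q * q * q) * (l * l * l) * (l * l * l) →
    PositiveRank (E₄-A a b c) (E₄-B a b c)
  fourth-multiple N 1<N {r} {l} {f} {g} r-int l≢0 L∣l p-unit f≡ g≡ identity =
    positive-rank-criterion p-int q-int N 1<N {x} {y} {κ} {z} xκ zy L∣z L∣κ curve
    where
    open Localisation N 1<N
    open Units N 1<N
    t = proj₁ (inverse l l≢0)
    lt : l * t ≡ 1ℚ
    lt = proj₂ (inverse l l≢0)
    l-loc : Local l
    l-loc = Local-∣ Local-L L∣l
    p-loc = Local-int p-int
    q-loc = Local-int q-int
    d-loc = Local-int d-int
    r-loc = Local-int r-int
    f-unit : Unit f
    f-unit = subst Unit (sym f≡) (Unit-+ (Unit-* p-unit p-unit) (∣-*ʳ L∣l (Local-neg (Local-* (Local-* (Local-int (Integral-ℕ 2)) q-loc) d-loc))))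
    g-unit : Unit g
    g-unit = subst Unit (sym g≡) (Unit-+ (Unit-* (Unit-* p-unit p-unit) p-unit) (∣-*ʳ L∣l (Local--
      (Local-* (Local-* (Local-* (Local-* (Local-* (Local-* r-loc r-loc) q-loc) q-loc) d-loc) d-loc) d-loc)
      (Local-* (Local-* (Local-* (Local-int (Integral-ℕ 4)) p-loc) q-loc) d-loc))))
    v = Unit.x⁻¹ f-unit
    fv : f * v ≡ 1ℚ
    fv = Unit.inverseʳ f-unit
    u = Unit.x⁻¹ g-unit
    gu : g * u ≡ 1ℚ
    gu = Unit.inverseʳ g-unit
    x = f * (t * t)
    y = g * (t * t * t)
    κ = l * l * v
    z = l * (f * u)
    lemma₁ : ∀ D t L v → D * (t * t) * (L * L * v) - 1ℚ ≡ (L * t) * (L * t) * (D * v - 1ℚ) + (L * t + 1ℚ) * (L * t - 1ℚ)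
    lemma₁ = solve-∀ ℚ-ring
    xκ : x * κ ≡ 1ℚ
    xκ = combine₂ ((l * t) * (l * t)) (l * t + 1ℚ) fv lt (lemma₁ f t l v)
    lemma₂ : ∀ l f u g t → l * (f * u) * (g * (t * t * t)) - f * (t * t) ≡ l * f * t * t * t * (g * u - 1ℚ) + f * t * t * (l * t - 1ℚ)
    lemma₂ = solve-∀ ℚ-ring
    zy : z * y ≡ x
    zy = combine₂ (l * f * t * t * t) (f * t * t) gu lt (lemma₂ l f u g t)
    L∣z : L ∣ z
    L∣z = ∣-*ʳ L∣l (Local-* (subst Local (sym f≡) (Local-+ (Local-* p-loc p-loc)
      (Local-* l-loc (Local-neg (Local-* (Local-* (Local-int (Integral-ℕ 2)) q-loc) d-loc))))) (Unit.x⁻¹-local g-unit))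
    L∣κ : L ∣ κ
    L∣κ = ∣-*ʳ (∣-*ʳ L∣l l-loc) (Unit.x⁻¹-local f-unit)
    lemma₃ : ∀ f g l t m n → let w = l * t in
      g * (t * t * t) * (g * (t * t * t)) - (f * (t * t) * (f * (t * t)) * (f * (t * t)) + (- m) * (f * (t * t)) * (f * (t * t)) + n)
        ≡ t * t * t * t * t * t * (g * g - (f * f * f - m * f * f * (l * l) + n * (l * l * l) * (l * l * l)))
          + (n * (w * w * w * w * w + w * w * w * w + w * w * w + w * w + w + 1ℚ) - m * f * f * (t * t * t * t) * (w + 1ℚ)) * (w - 1ℚ)
    lemma₃ = solve-∀ ℚ-ring
    curve : y * y ≡ x * x * x + (- (p * q)) * x * x + d * d * (q * q * q * q)
    curve = combine₂ (t * t * t * t * t * t)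
      (n * (w * w * w * w * w + w * w * w * w + w * w * w + w * w + w + 1ℚ) - p * q * f * f * (t * t * t * t) * (w + 1ℚ))
      identity lt (lemma₃ f g l t (p * q) n)
      where
      w = l * t
      n = d * d * (q * q * q * q)

  -- Here the point is six times (0 , (p − q) q²).
  sixth-multiple : p ≡ 2ℚ → q ≡ 3ℚ → PositiveRank (E₄-A a b c) (E₄-B a b c)
  sixth-multiple p≡2 q≡3 = positive-rank-criterion p-int q-int 2 1<2 {x} {y} {κ} {z} refl refl L∣z L∣κ
      (cong₂ (λ p q → x * x * x + (- (p * q)) * x * x + (p - q) * (p - q) * (q * q * q * q)) (sym p≡2) (sym q≡3))
    where
    1<2 : 1 ℕ.< 2
    1<2 = ℕ.s≤s (ℕ.s≤s ℕ.z≤n)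
    open Localisation 2 1<2
    x y κ z : ℚ
    x = + 33 / 16
    y = + 513 / 64
    κ = + 16 / 33
    z = + 44 / 171
    L≡2 : L ≡ 2ℚ
    L≡2 = ι-ℕ 2
    L∣z : L ∣ z
    L∣z = divides {quotient = + 22 / 171} (local {k = ℚ[ 85 ]} {a = ℚ[ 22 ]} (Integral-ℕ 85) (Integral-ℕ 22)
      (cong (λ L → (+ 22 / 171) * (1ℚ + L * ℚ[ 85 ])) L≡2)) (cong (_* (+ 22 / 171)) (sym L≡2))
    L∣κ : L ∣ κ
    L∣κ = divides {quotient = + 8 / 33} (local {k = ℚ[ 16 ]} {a = ℚ[ 8 ]} (Integral-ℕ 16) (Integral-ℕ 8)
      (cong (λ L → (+ 8 / 33) * (1ℚ + L * ℚ[ 16 ])) L≡2)) (cong (_* (+ 8 / 33)) (sym L≡2))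

absolute-value : ∀ i → ∃ λ ε → Integral ε × ε * ε ≡ 1ℚ × ι (+ ℤ.∣ i ∣) ≡ ε * ι i
absolute-value (+ n) = 1ℚ , Integral-ℕ 1 , refl , sym (*-identityˡ (ι (+ n)))
absolute-value -[1+ n ] = - 1ℚ , Integral-neg (Integral-ℕ 1) , refl ,
  trans (ι-neg -[1+ n ]) (neg-distribˡ-*′ (ι -[1+ n ]))
  where
  neg-distribˡ-*′ : ∀ x → - x ≡ (- 1ℚ) * x
  neg-distribˡ-*′ = solve-∀ ℚ-ring

signed-magnitude : ∀ {x} → Integral x → x ≢ 0ℚ → ∃₂ λ m ε → Integral ε × ε * ε ≡ 1ℚ × x ≡ ι (+ suc m) * ε
signed-magnitude (i , refl) x≢0 with ℤ.∣ i ∣ | absolute-value i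
... | n | ε , ε-int , εε , abs with n
...   | zero = contradiction (combine₂ (- (ι i)) ε εε (sym (trans (sym (ι-ℕ 0)) abs)) (lemma ε (ι i))) x≢0
  where
  lemma : ∀ ε x → x - 0ℚ ≡ (- x) * (ε * ε - 1ℚ) + ε * (ε * x - 0ℚ)
  lemma = solve-∀ ℚ-ring
...   | suc m = m , ε , ε-int , εε , combine₂ (- (ι i)) (- ε) εε abs (lemma ε (ι i) (ι (+ suc m)))
  where
  lemma : ∀ ε x m → x - m * ε ≡ (- x) * (ε * ε - 1ℚ) + (- ε) * (m - ε * x)
  lemma = solve-∀ ℚ-ring

ι-1+* : ∀ k l m n → 1 ℕ.+ k ℕ.* l ≡ m ℕ.* n → 1ℚ + ι (+ k) * ι (+ l) ≡ ι (+ m) * ι (+ n)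
ι-1+* k l m n eq = trans (cong (λ x → 1ℚ + x) (sym (ι-ℕ* k l))) (trans (sym (ι-suc (k ℕ.* l))) (trans (cong (λ x → ι (+ x)) eq) (ι-ℕ* m n)))
  where
  ι-ℕ* : ∀ k l → ι (+ (k ℕ.* l)) ≡ ι (+ k) * ι (+ l)
  ι-ℕ* k l = trans (cong ι (ℤ.pos-* k l)) (ι-* (+ k) (+ l))

bezout : ∀ m n → Coprime m n → ∃₂ λ s t → Integral s × Integral t × s * ι (+ m) + t * ι (+ n) ≡ 1ℚ
bezout m n m⊥n with coprime-Bézout m⊥n
... | Bézout.+- x y eq = ι (+ x) , - ι (+ y) , Integral-ι (+ x) , Integral-neg (Integral-ι (+ y)) ,
  combine₁ (- 1ℚ) (ι-1+* y n x m eq) (lemma (ι (+ x)) (ι (+ m)) (ι (+ y)) (ι (+ n)))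
  where
  lemma : ∀ x m y n → x * m + (- y) * n - 1ℚ ≡ (- 1ℚ) * (1ℚ + y * n - x * m)
  lemma = solve-∀ ℚ-ring
... | Bézout.-+ x y eq = - ι (+ x) , ι (+ y) , Integral-neg (Integral-ι (+ x)) , Integral-ι (+ y) ,
  combine₁ (- 1ℚ) (ι-1+* x m y n eq) (lemma (ι (+ x)) (ι (+ m)) (ι (+ y)) (ι (+ n)))
  where
  lemma : ∀ x m y n → (- x) * m + y * n - 1ℚ ≡ (- 1ℚ) * (1ℚ + x * m - y * n)
  lemma = solve-∀ ℚ-ring

module _ {a b c q : ℚ} (a≢0 : a ≢ 0ℚ) (b≢0 : b ≢ 0ℚ) (q≢0 : q ≢ 0ℚ) (q-int : Integral q) where

  private
    PositiveRank-E₄ : Set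
    PositiveRank-E₄ = PositiveRank (E₄-A a b c) (E₄-B a b c)

    odd-large : ∀ k → ι (+ (1 ℕ.+ 2 ℕ.* suc k)) ≡ 1ℚ + 2ℚ * ι (+ suc k)
    odd-large k = trans (ι-suc (2 ℕ.* suc k)) (cong (λ x → 1ℚ + x) (trans (cong ι (ℤ.pos-* 2 (suc k))) (trans (ι-* (+ 2) (+ suc k)) (cong (_* ι (+ suc k)) (ι-ℕ 2)))))

  Ratio : ℚ → Set
  Ratio p = 3ℚ * a * c * q ≡ b * b * p

  q-unit : ∀ {p} N (1<N : 1 ℕ.< N) →
    let open Localisation N 1<N
        open Units N 1<N
    in L ∣ p → ∀ {s t} → Integral s → Integral t → s * p + t * q ≡ 1ℚ → Unit q
  q-unit {p} N 1<N L∣p {s} {t} s-int t-int bez = Unit-by (Local-int t-int) (∣-neg (∣-*ʳ L∣p (Local-int s-int)))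
      (combine₁ 1ℚ bez (lemma s p t q))
    where
    open Localisation N 1<N
    open Units N 1<N
    lemma : ∀ s p t q → q * t - (1ℚ + (- (p * s))) ≡ 1ℚ * (s * p + t * q - 1ℚ)
    lemma = solve-∀ ℚ-ring

  case-odd : ∀ k → let p = ι (+ (1 ℕ.+ 2 ℕ.* suc k)) in Ratio p →
    ∀ {s t} → Integral s → Integral t → s * p + t * q ≡ 1ℚ → PositiveRank-E₄
  case-odd k ratio s-int t-int bez = third-multiple a≢0 b≢0 q≢0 ratio (Integral-ι (+ N)) q-int N 1<N
      {1ℚ} {2ℚ} (Integral-ℕ 1) (Integral-ℕ 2) refl (sym (*-identityˡ L)) 2-unit
      (q-unit N 1<N (∣-refl {L}) s-int t-int bez)
    where
    N = 1 ℕ.+ 2 ℕ.* suc k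
    1<N : 1 ℕ.< N
    1<N = ℕ.s≤s (ℕ.s≤s ℕ.z≤n)
    open Localisation N 1<N
    open Units N 1<N
    2-unit : Unit 2ℚ
    2-unit = Unit-by (Local-neg (Local-int (Integral-ι (+ suc k)))) (∣-neg (∣-refl {L}))
      (combine₁ 1ℚ (odd-large k) (lemma (ι (+ suc k)) L))
      where
      lemma : ∀ k L → ℚ[ 2 ] * (- k) - (1ℚ + (- L)) ≡ 1ℚ * (L - (1ℚ + ℚ[ 2 ] * k))
      lemma = solve-∀ ℚ-ring

  case-even : ∀ k → let N = 2 ℕ.+ k; p = 2ℚ * ι (+ N) in Ratio p →
    ∀ {s t} → Integral s → Integral t → s * p + t * q ≡ 1ℚ → PositiveRank-E₄
  case-even k ratio s-int t-int bez = third-multiple a≢0 b≢0 q≢0 ratio (Integral-* (Integral-ℕ 2) (Integral-ι (+ N))) q-int N 1<N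
      {2ℚ} {1ℚ} (Integral-ℕ 2) (Integral-ℕ 1) refl refl (unit Local-1 refl)
      (q-unit N 1<N L∣2L s-int t-int bez)
    where
    N = 2 ℕ.+ k
    1<N : 1 ℕ.< N
    1<N = ℕ.s≤s (ℕ.s≤s ℕ.z≤n)
    open Localisation N 1<N
    open Units N 1<N
    L∣2L : L ∣ 2ℚ * L
    L∣2L = subst (L ∣_) (*-comm L 2ℚ) (∣-*ʳ (∣-refl {L}) (Local-int (Integral-ℕ 2)))

  case-1 : Ratio 1ℚ → 1ℚ ≢ q → PositiveRank-E₄
  case-1 ratio 1≢q with signed-magnitude (Integral-+ (Integral-ℕ 1) (Integral-neg q-int)) (λ 1-q≡0 → 1≢q (x-y≡0⇒x≡y 1-q≡0))
  ... | m , ε , ε-int , _ , d≡ = fourth-multiple a≢0 b≢0 q≢0 ratio (Integral-ℕ 1) q-int N 1<N {2ℚ} {2ℚ * (1ℚ - q)}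
      (Integral-ℕ 2) (*-≢0 {2ℚ} {1ℚ - q} (λ ()) (λ 1-q≡0 → 1≢q (x-y≡0⇒x≡y 1-q≡0))) L∣l (unit Local-1 refl)
      (f≡ q (1ℚ - q)) (g≡ q (1ℚ - q)) (identity q (1ℚ - q))
    where
    N = 2 ℕ.* suc m
    1<N : 1 ℕ.< N
    1<N = ℕ.m≤m*n 2 (suc m)
    open Localisation N 1<N
    open Units N 1<N
    L≡ : L ≡ 2ℚ * ι (+ suc m)
    L≡ = trans (cong ι (ℤ.pos-* 2 (suc m))) (trans (ι-* (+ 2) (+ suc m)) (cong (_* ι (+ suc m)) (ι-ℕ 2)))
    L∣l : L ∣ 2ℚ * (1ℚ - q)
    L∣l = divides (Local-int ε-int) (trans (cong (2ℚ *_) d≡) (trans (sym (*-assoc 2ℚ (ι (+ suc m)) ε)) (cong (_* ε) (sym L≡))))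
    f≡ : ∀ q d → 1ℚ - ℚ[ 4 ] * (q * d * d) ≡ 1ℚ * 1ℚ + ℚ[ 2 ] * d * (- (ℚ[ 2 ] * q * d))
    f≡ = solve-∀ ℚ-ring
    g≡ : ∀ q d → 1ℚ - ℚ[ 8 ] * (q * d * d) + ℚ[ 8 ] * (q * d * d) * (q * d * d)
      ≡ 1ℚ * 1ℚ * 1ℚ + ℚ[ 2 ] * d * (ℚ[ 2 ] * ℚ[ 2 ] * q * q * d * d * d - ℚ[ 4 ] * 1ℚ * q * d)
    g≡ = solve-∀ ℚ-ring
    identity : ∀ q d → let w = q * d * d; l = ℚ[ 2 ] * d; f = 1ℚ - ℚ[ 4 ] * w; g = 1ℚ - ℚ[ 8 ] * w + ℚ[ 8 ] * w * w in
      g * g ≡ f * f * f - 1ℚ * q * f * f * (l * l) + d * d * (q * q * q * q) * (l * l * l) * (l * l * l)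
    identity = solve-∀ ℚ-ring

  case-2 : Ratio 2ℚ → 2ℚ ≢ q → 1ℚ ≢ q → ∀ {s t} → Integral s → Integral t → s * 2ℚ + t * q ≡ 1ℚ → PositiveRank-E₄
  case-2 ratio 2≢q 1≢q {s} {t} s-int t-int bez
    with signed-magnitude (Integral-+ (Integral-ℕ 2) (Integral-neg q-int)) (λ 2-q≡0 → 2≢q (x-y≡0⇒x≡y 2-q≡0))
  ... | zero , ε , ε-int , εε , d≡ = sixth-multiple a≢0 b≢0 q≢0 ratio (Integral-ℕ 2) q-int refl
      (x-y≡0⇒x≡y (*≡0⇒ {1ℚ - q} {q - 3ℚ} (λ 1-q≡0 → 1≢q (x-y≡0⇒x≡y 1-q≡0))
        (combine₂ (- (2ℚ - q + ε)) (- 1ℚ) (trans d≡ (trans (cong (_* ε) (ι-ℕ 1)) (*-identityˡ ε))) εε (lemma q ε))))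
    where
    lemma : ∀ q ε → (1ℚ - q) * (q - ℚ[ 3 ]) - 0ℚ ≡ (- (ℚ[ 2 ] - q + ε)) * (ℚ[ 2 ] - q - ε) + (- 1ℚ) * (ε * ε - 1ℚ)
    lemma = solve-∀ ℚ-ring
  ... | suc m , ε , ε-int , _ , d≡ = fourth-multiple a≢0 b≢0 q≢0 ratio (Integral-ℕ 2) q-int N 1<N {1ℚ} {2ℚ - q}
      (Integral-ℕ 1) (λ 2-q≡0 → 2≢q (x-y≡0⇒x≡y 2-q≡0)) L∣l 2-unit
      (f≡ q (2ℚ - q)) (g≡ q (2ℚ - q)) (identity q (2ℚ - q))
    where
    N = 2 ℕ.+ m
    1<N : 1 ℕ.< N
    1<N = ℕ.s≤s (ℕ.s≤s ℕ.z≤n)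
    open Localisation N 1<N
    open Units N 1<N
    L∣l : L ∣ 2ℚ - q
    L∣l = divides (Local-int ε-int) d≡
    2-unit : Unit 2ℚ
    2-unit = Unit-by (Local-int (Integral-+ s-int t-int)) (∣-*ʳ L∣l (Local-int t-int)) (combine₁ 1ℚ bez (lemma s t q))
      where
      lemma : ∀ s t q → ℚ[ 2 ] * (s + t) - (1ℚ + (ℚ[ 2 ] - q) * t) ≡ 1ℚ * (s * ℚ[ 2 ] + t * q - 1ℚ)
      lemma = solve-∀ ℚ-ring
    f≡ : ∀ q d → ℚ[ 4 ] - ℚ[ 2 ] * (q * d * d) ≡ ℚ[ 2 ] * ℚ[ 2 ] + d * (- (ℚ[ 2 ] * q * d))
    f≡ = solve-∀ ℚ-ring
    g≡ : ∀ q d → ℚ[ 8 ] - ℚ[ 8 ] * (q * d * d) + (q * d * d) * (q * d * d)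
      ≡ ℚ[ 2 ] * ℚ[ 2 ] * ℚ[ 2 ] + d * (1ℚ * 1ℚ * q * q * d * d * d - ℚ[ 4 ] * ℚ[ 2 ] * q * d)
    g≡ = solve-∀ ℚ-ring
    identity : ∀ q d → let w = q * d * d; f = ℚ[ 4 ] - ℚ[ 2 ] * w; g = ℚ[ 8 ] - ℚ[ 8 ] * w + w * w in
      g * g ≡ f * f * f - ℚ[ 2 ] * q * f * f * (d * d) + d * d * (q * q * q * q) * (d * d * d) * (d * d * d)
    identity = solve-∀ ℚ-ring

  positive-rank-coprime : ∀ m → Ratio (ι (+ m)) → ι (+ m) ≢ 0ℚ → ι (+ m) ≢ q → ι (+ m) ≢ 2ℚ * q →
    ∀ {s t} → Integral s → Integral t → s * ι (+ m) + t * q ≡ 1ℚ → PositiveRank-E₄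
  positive-rank-coprime m ratio p≢0 p≢q p≢2q {s} {t} s-int t-int bez with even-or-odd m
  ... | zero , inj₁ refl = contradiction (ι-ℕ 0) p≢0
  ... | suc zero , inj₁ refl = case-2 (subst Ratio (ι-ℕ 2) ratio) (λ 2≡q → p≢q (trans (ι-ℕ 2) 2≡q))
      (λ 1≡q → p≢2q (trans (ι-ℕ 2) (cong (2ℚ *_) 1≡q))) s-int t-int (subst (λ p → s * p + t * q ≡ 1ℚ) (ι-ℕ 2) bez)
  ... | suc (suc k) , inj₁ refl = case-even k (subst Ratio p≡2L ratio) s-int t-int (subst (λ p → s * p + t * q ≡ 1ℚ) p≡2L bez)
    where
    p≡2L : ι (+ (2 ℕ.* (2 ℕ.+ k))) ≡ 2ℚ * ι (+ (2 ℕ.+ k))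
    p≡2L = trans (cong ι (ℤ.pos-* 2 (2 ℕ.+ k))) (trans (ι-* (+ 2) (+ (2 ℕ.+ k))) (cong (_* ι (+ (2 ℕ.+ k))) (ι-ℕ 2)))
  ... | zero , inj₂ refl = case-1 (subst Ratio (ι-ℕ 1) ratio) (λ 1≡q → p≢q (trans (ι-ℕ 1) 1≡q))
  ... | suc k , inj₂ refl = case-odd k ratio s-int t-int bez

coprime-fraction : ∀ h → ∃₂ λ m q → Integral q × q ≢ 0ℚ × h * q ≡ ι (+ m) ×
  ∃₂ λ s t → Integral s × Integral t × s * ι (+ m) + t * q ≡ 1ℚ
coprime-fraction h@(mkℚ i n-1 i⊥n) =
  let ε , ε-int , εε , abs = absolute-value i
      s , t , s-int , t-int , bez = bezout ℤ.∣ i ∣ (suc n-1) (Coprimality.recompute i⊥n)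
      n = ι (+ suc n-1)
  in ℤ.∣ i ∣ , n * ε , Integral-* (Integral-ι (+ suc n-1)) ε-int
   , *-≢0 {n} {ε} (λ n≡0 → n≢0 (ι-injective (trans n≡0 (sym (ι-ℕ 0))))) (unit≢0 {ε} {ε} εε)
   , trans (lemma₁ h n ε) (trans (cong (ε *_) (p*↧p≡↥p h)) (sym abs))
   , s , t * ε , s-int , Integral-* t-int ε-int
   , combine₂ 1ℚ (t * n) bez εε (lemma₂ s t ε (ι (+ ℤ.∣ i ∣)) n)
  where
  n≢0 : + suc n-1 ≢ + 0
  n≢0 ()
  lemma₁ : ∀ h n ε → h * (n * ε) ≡ ε * (h * n)
  lemma₁ = solve-∀ ℚ-ring
  lemma₂ : ∀ s t ε m n → s * m + t * ε * (n * ε) - 1ℚ ≡ 1ℚ * (s * m + t * n - 1ℚ) + t * n * (ε * ε - 1ℚ)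
  lemma₂ = solve-∀ ℚ-ring

positive-rank : ∀ {a b c} → a ≢ 0ℚ → b ≢ 0ℚ → c ≢ 0ℚ → 3ℚ * a * c - b * b ≢ 0ℚ → 3ℚ * a * c ≢ 2ℚ * (b * b) →
  PositiveRank (E₄-A a b c) (E₄-B a b c)
positive-rank {a} {b} {c} a≢0 b≢0 c≢0 3ac-bb≢0 3ac≢2bb =
  let m , q , q-int , q≢0 , hq≡p , s , t , s-int , t-int , bez = coprime-fraction h
      ratio : 3ℚ * a * c * q ≡ b * b * ι (+ m)
      ratio = combine₂ (b * b) (- (3ℚ * a * c * q)) hq≡p bb⁻¹ (lemma₁ a b c q i (ι (+ m)))
  in positive-rank-coprime a≢0 b≢0 q≢0 q-int m ratio
       (λ p≡0 → 3ac≢0 (*≡0⇒ {q} {3ℚ * a * c} q≢0 (trans (*-comm q (3ℚ * a * c)) (trans ratio (trans (cong (b * b *_) p≡0) (*-zeroʳ (b * b)))))))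
       (λ p≡q → 3ac-bb≢0 (*≡0⇒ {q} {3ℚ * a * c - b * b} q≢0 (combine₂ 1ℚ (b * b) ratio p≡q (lemma₂ a b c q (ι (+ m))))))
       (λ p≡2q → 3ac≢2bb (x-y≡0⇒x≡y (*≡0⇒ {q} {3ℚ * a * c - 2ℚ * (b * b)} q≢0 (combine₂ 1ℚ (b * b) ratio p≡2q (lemma₃ a b c q (ι (+ m)))))))
       s-int t-int bez
  where
  bb≢0 : b * b ≢ 0ℚ
  bb≢0 = *-≢0 {b} {b} b≢0 b≢0
  i = proj₁ (inverse (b * b) bb≢0)
  bb⁻¹ : b * b * i ≡ 1ℚ
  bb⁻¹ = proj₂ (inverse (b * b) bb≢0)
  h = 3ℚ * a * c * i
  3ac≢0 : 3ℚ * a * c ≢ 0ℚ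
  3ac≢0 = *-≢0 {3ℚ * a} {c} (*-≢0 {3ℚ} {a} (λ ()) a≢0) c≢0
  lemma₁ : ∀ a b c q i p → ℚ[ 3 ] * a * c * q - b * b * p ≡ b * b * (ℚ[ 3 ] * a * c * i * q - p) + (- (ℚ[ 3 ] * a * c * q)) * (b * b * i - 1ℚ)
  lemma₁ = solve-∀ ℚ-ring
  lemma₂ : ∀ a b c q p → q * (ℚ[ 3 ] * a * c - b * b) - 0ℚ ≡ 1ℚ * (ℚ[ 3 ] * a * c * q - b * b * p) + b * b * (p - q)
  lemma₂ = solve-∀ ℚ-ring
  lemma₃ : ∀ a b c q p → q * (ℚ[ 3 ] * a * c - ℚ[ 2 ] * (b * b)) - 0ℚ ≡ 1ℚ * (ℚ[ 3 ] * a * c * q - b * b * p) + b * b * (p - ℚ[ 2 ] * q)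
  lemma₃ = solve-∀ ℚ-ring

-- Rank zero

module _ {m n : ℕ} {x y : ℚ} where
  infixl 7 _⊗_
  infixl 6 _⊕_

  _⊕_ : ι (+ m) ≡ x → ι (+ n) ≡ y → ι (+ (m ℕ.+ n)) ≡ x + y
  eq ⊕ eq′ = trans (ι-+ (+ m) (+ n)) (cong₂ _+_ eq eq′)

  _⊗_ : ι (+ m) ≡ x → ι (+ n) ≡ y → ι (+ (m ℕ.* n)) ≡ x * y
  eq ⊗ eq′ = trans (cong ι (ℤ.pos-* m n)) (trans (ι-* (+ m) (+ n)) (cong₂ _*_ eq eq′))

opaque
  same-image : ∀ {m n x} → ι (+ m) ≡ x → ι (+ n) ≡ x → m ≡ n
  same-image eq eq′ = ℤ.+-injective (ι-injective (trans eq (sym eq′)))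

  ζ-unit : ∀ ζ x N → ζ * ι (+ N) ≡ x → N ≡ 1 → ζ ≡ x
  ζ-unit ζ x N eq N≡1 = trans (sym (*-identityʳ ζ)) (trans (cong (ζ *_) (sym (trans (cong (λ N → ι (+ N)) N≡1) (ι-ℕ 1)))) eq)

  positive-ζ : ∀ ζ y m N r T ε → T ≢ 0 → m ≢ 0 → N ≢ 0 → Coprime m N → ε * ε ≡ 1ℚ →
    ι (+ r) ≡ ε * (y * ι (+ T)) → ι (+ m) ≡ ζ * ι (+ N) → y * y ≡ ζ * ζ * ζ + ζ * ζ - ζ → ζ ≡ 1ℚ
  positive-ζ ζ y m N r T ε T≢0 m≢0 N≢0 m⊥N εε ρ μ curve =
    let m≡1 , N≡1 = positive-point m N r T T≢0 m≢0 N≢0 m⊥N (same-image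
          (ρ ⊗ ρ ⊗ (ν ⊗ ν ⊗ ν) ⊕ τ ⊗ τ ⊗ (μ ⊗ (ν ⊗ ν)))
          (trans (τ ⊗ τ ⊗ (μ ⊗ (μ ⊗ μ ⊕ ν ⊗ μ)))
            (sym (combine₂ (t * t * (n * n * n)) (y * y * t * t * (n * n * n)) curve εε (lemma ζ y n t ε)))))
    in ζ-unit ζ 1ℚ N (trans (sym μ) (trans (cong (λ m → ι (+ m)) m≡1) (ι-ℕ 1))) N≡1
    where
    n t : ℚ
    n = ι (+ N)
    t = ι (+ T)
    ν : ι (+ N) ≡ n
    ν = refl
    τ : ι (+ T) ≡ t
    τ = refl
    lemma : ∀ ζ y n t ε → ε * (y * t) * (ε * (y * t)) * (n * n * n) + t * t * (ζ * n * (n * n)) - t * t * (ζ * n * (ζ * n * (ζ * n) + n * (ζ * n)))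
      ≡ t * t * (n * n * n) * (y * y - (ζ * ζ * ζ + ζ * ζ - ζ)) + y * y * t * t * (n * n * n) * (ε * ε - 1ℚ)
    lemma = solve-∀ ℚ-ring

  negative-ζ : ∀ ζ y m N r T ε → T ≢ 0 → m ≢ 0 → N ≢ 0 → Coprime m N → ε * ε ≡ 1ℚ →
    ι (+ r) ≡ ε * (y * ι (+ T)) → ι (+ m) ≡ - (ζ * ι (+ N)) → y * y ≡ ζ * ζ * ζ + ζ * ζ - ζ → ζ ≡ - 1ℚ
  negative-ζ ζ y m N r T ε T≢0 m≢0 N≢0 m⊥N εε ρ μ curve =
    let m≡1 , N≡1 = negative-point m N r T T≢0 m≢0 N≢0 m⊥N (same-image
          (ρ ⊗ ρ ⊗ (ν ⊗ ν ⊗ ν) ⊕ τ ⊗ τ ⊗ (μ ⊗ (μ ⊗ μ)))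
          (trans (τ ⊗ τ ⊗ (μ ⊗ (ν ⊗ ν ⊕ μ ⊗ ν)))
            (sym (combine₂ (t * t * (n * n * n)) (y * y * t * t * (n * n * n)) curve εε (lemma ζ y n t ε)))))
    in ζ-unit ζ (- 1ℚ) N (trans (lemma′ (ζ * n)) (cong -_ (trans (sym μ) (trans (cong (λ m → ι (+ m)) m≡1) (ι-ℕ 1))))) N≡1
    where
    n t : ℚ
    n = ι (+ N)
    t = ι (+ T)
    ν : ι (+ N) ≡ n
    ν = refl
    τ : ι (+ T) ≡ t
    τ = refl
    lemma : ∀ ζ y n t ε → let m = - (ζ * n) in
      ε * (y * t) * (ε * (y * t)) * (n * n * n) + t * t * (m * (m * m)) - t * t * (m * (n * n + m * n))
      ≡ t * t * (n * n * n) * (y * y - (ζ * ζ * ζ + ζ * ζ - ζ)) + y * y * t * t * (n * n * n) * (ε * ε - 1ℚ)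
    lemma = solve-∀ ℚ-ring
    lemma′ : ∀ x → x ≡ - (- x)
    lemma′ = solve-∀ ℚ-ring

  rational-points : ∀ ζ y → y * y ≡ ζ * ζ * ζ + ζ * ζ - ζ → ζ ≡ 0ℚ ⊎ ζ ≡ 1ℚ ⊎ ζ ≡ - 1ℚ
  rational-points ζ@(mkℚ (+ zero) _ _) y curve = inj₁ (↥p≡0⇒p≡0 ζ refl)
  rational-points ζ@(mkℚ +[1+ m ] n cop) y curve =
    let ε , _ , εε , abs = absolute-value (↥ y)
    in inj₂ (inj₁ (positive-ζ ζ y (suc m) (suc n) ℤ.∣ ↥ y ∣ (↧ₙ y) ε (↧ₙ≢0 y) (λ ()) (λ ()) (Coprimality.recompute cop) εε
         (trans abs (cong (ε *_) (sym (p*↧p≡↥p y)))) (sym (p*↧p≡↥p ζ)) curve))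
    where
    ↧ₙ≢0 : ∀ y → ↧ₙ y ≢ 0
    ↧ₙ≢0 (mkℚ _ _ _) ()
  rational-points ζ@(mkℚ -[1+ m ] n cop) y curve =
    let ε , _ , εε , abs = absolute-value (↥ y)
    in inj₂ (inj₂ (negative-ζ ζ y (suc m) (suc n) ℤ.∣ ↥ y ∣ (↧ₙ y) ε (↧ₙ≢0 y) (λ ()) (λ ()) (Coprimality.recompute cop) εε
         (trans abs (cong (ε *_) (sym (p*↧p≡↥p y)))) (trans (ι-neg -[1+ m ]) (cong -_ (sym (p*↧p≡↥p ζ)))) curve))
    where
    ↧ₙ≢0 : ∀ y → ↧ₙ y ≢ 0
    ↧ₙ≢0 (mkℚ _ _ _) ()

module _ {a b c : ℚ} (a≢0 : a ≢ 0ℚ) (b≢0 : b ≢ 0ℚ) (bb≡3/2ac : b * b ≡ (+ 3 / 2) * a * c) where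

  private
    μ s a₂ : ℚ
    μ = a * b
    s = a * a * a * c
    a₂ = - 2ℚ

    μ≢0 : μ ≢ 0ℚ
    μ≢0 = *-≢0 {a} {b} a≢0 b≢0

    μμa₂≡-3s : μ * μ * a₂ ≡ - (3ℚ * s)
    μμa₂≡-3s = combine₁ (- (2ℚ * a * a)) bb≡3/2ac (lemma a b c)
      where
      lemma : ∀ a b c → (a * b) * (a * b) * (- ℚ[ 2 ]) - (- (ℚ[ 3 ] * (a * a * a * c)))
        ≡ (- (ℚ[ 2 ] * a * a)) * (b * b - (+ 3 / 2) * a * c)
      lemma = solve-∀ ℚ-ring

    A≡-3ss : E₄-A a b c ≡ - (3ℚ * s * s)
    A≡-3ss = lemma a c
      where
      lemma : ∀ a c → - (ℚ[ 3 ] * (a * a * a * a * a * a) * c * c) ≡ - (ℚ[ 3 ] * (a * a * a * c) * (a * a * a * c))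
      lemma = solve-∀ ℚ-ring

    B≡μ⁶-2sss : E₄-B a b c ≡ (μ * μ * μ) * (μ * μ * μ) - 2ℚ * s * s * s
    B≡μ⁶-2sss = combine₁ (- (ℚ[ 6 ] * (a * a * a * a * a * a) * (a * c) * (b * b))) bb≡3/2ac (lemma a b c)
      where
      lemma : ∀ a b c → let a⁶ = a * a * a * a * a * a; μ = a * b; s = a * a * a * c in
        - (a⁶ * (ℚ[ 2 ] * a * c - b * b) * (a * a * c * c - ℚ[ 4 ] * a * b * b * c + b * b * b * b))
            - ((μ * μ * μ) * (μ * μ * μ) - ℚ[ 2 ] * s * s * s)
          ≡ (- (ℚ[ 6 ] * a⁶ * (a * c) * (b * b))) * (b * b - (+ 3 / 2) * a * c)
      lemma = solve-∀ ℚ-ring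

    A₄ B₄ : ℚ
    A₄ = E₄-A a b c
    B₄ = E₄-B a b c

  open Model A₄ a₂ s μ μ≢0 μμa₂≡-3s A≡-3ss

  private
    Torsion : Point → Set
    Torsion P = Σ[ n ∈ ℕ ] mul A₄ (suc n) P ≡ O

    two-torsion : Torsion (E 1ℚ 0ℚ)
    two-torsion = 1 , add-opposite {1ℚ} {0ℚ} {0ℚ} refl

    three-torsion : ∀ y → y ≡ 1ℚ ⊎ y ≡ - 1ℚ → Torsion (E 2ℚ y)
    three-torsion _ (inj₁ refl) = 2 , trans (cong (add A₄ (E 2ℚ 1ℚ)) (add-tangent {2ℚ} {2ℚ} {1ℚ} (λ ()) refl)) (add-opposite {2ℚ} {1ℚ} { - 1ℚ} refl)
    three-torsion _ (inj₂ refl) = 2 , trans (cong (add A₄ (E 2ℚ (- 1ℚ))) (add-tangent { - 2ℚ} {2ℚ} { - 1ℚ} (λ ()) refl)) (add-opposite {2ℚ} { - 1ℚ} {1ℚ} refl)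

    six-torsion : ∀ y → y ≡ 1ℚ ⊎ y ≡ - 1ℚ → Torsion (E 0ℚ y)
    six-torsion y y≡±1 = 5 , trans (cong +P (trans (cong +P (trans (cong +P (trans (cong +P (P+P y≡±1)) (P+2P y≡±1))) (P+3P y≡±1))) (P+4P y≡±1))) (P+5P y≡±1)
      where
      +P : Point → Point
      +P = add A₄ (E 0ℚ y)
      P+P : y ≡ 1ℚ ⊎ y ≡ - 1ℚ → +P (E 0ℚ y) ≡ E 2ℚ (- y)
      P+P (inj₁ refl) = add-tangent {0ℚ} {0ℚ} {1ℚ} (λ ()) refl
      P+P (inj₂ refl) = add-tangent {0ℚ} {0ℚ} { - 1ℚ} (λ ()) refl
      P+2P : y ≡ 1ℚ ⊎ y ≡ - 1ℚ → +P (E 2ℚ (- y)) ≡ E 1ℚ 0ℚ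
      P+2P (inj₁ refl) = add-chord { - 1ℚ} {0ℚ} {1ℚ} {2ℚ} { - 1ℚ} (λ ()) refl
      P+2P (inj₂ refl) = add-chord {1ℚ} {0ℚ} { - 1ℚ} {2ℚ} {1ℚ} (λ ()) refl
      P+3P : y ≡ 1ℚ ⊎ y ≡ - 1ℚ → +P (E 1ℚ 0ℚ) ≡ E 2ℚ y
      P+3P (inj₁ refl) = add-chord { - 1ℚ} {0ℚ} {1ℚ} {1ℚ} {0ℚ} (λ ()) refl
      P+3P (inj₂ refl) = add-chord {1ℚ} {0ℚ} { - 1ℚ} {1ℚ} {0ℚ} (λ ()) refl
      P+4P : y ≡ 1ℚ ⊎ y ≡ - 1ℚ → +P (E 2ℚ y) ≡ E 0ℚ (- y)
      P+4P (inj₁ refl) = add-chord {0ℚ} {0ℚ} {1ℚ} {2ℚ} {1ℚ} (λ ()) refl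
      P+4P (inj₂ refl) = add-chord {0ℚ} {0ℚ} { - 1ℚ} {2ℚ} { - 1ℚ} (λ ()) refl
      P+5P : y ≡ 1ℚ ⊎ y ≡ - 1ℚ → +P (E 0ℚ (- y)) ≡ O
      P+5P (inj₁ refl) = add-opposite {0ℚ} {1ℚ} { - 1ℚ} refl
      P+5P (inj₂ refl) = add-opposite {0ℚ} { - 1ℚ} {1ℚ} refl

    ±1 : ∀ y → y * y ≡ 1ℚ → y ≡ 1ℚ ⊎ y ≡ - 1ℚ
    ±1 y yy≡1 with y ≟ 1ℚ
    ... | yes y≡1 = inj₁ y≡1
    ... | no y≢1 = inj₂ (x-y≡0⇒x≡y (*≡0⇒ {y - 1ℚ} (λ y-1≡0 → y≢1 (x-y≡0⇒x≡y y-1≡0)) (trans (lemma y) (x≡y⇒x-y≡0 yy≡1))))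
      where
      lemma : ∀ y → (y - 1ℚ) * (y - (- 1ℚ)) ≡ y * y - 1ℚ
      lemma = solve-∀ ℚ-ring

    torsion : ∀ ζ y → y * y ≡ ζ * ζ * ζ + ζ * ζ - ζ → Torsion (E (ζ + 1ℚ) y)
    torsion ζ y curve with rational-points ζ y curve
    ... | inj₁ refl = subst (λ y → Torsion (E 1ℚ y)) (sym y≡0) two-torsion
      where
      y≡0 : y ≡ 0ℚ
      y≡0 with y ≟ 0ℚ
      ... | yes y≡0 = y≡0
      ... | no y≢0 = *≡0⇒ {y} y≢0 curve
    ... | inj₂ (inj₁ refl) = three-torsion y (±1 y curve)
    ... | inj₂ (inj₂ refl) = six-torsion y (±1 y curve)

  rank-zero : RankZero A₄ B₄
  rank-zero O _ = 0 , refl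
  rank-zero (pt X Y) on-curve = subst Torsion (cong₂ pt X≡ Y≡) (torsion ζ y curve)
    where
    i = proj₁ (inverse μ μ≢0)
    μi : μ * i ≡ 1ℚ
    μi = proj₂ (inverse μ μ≢0)
    ζ = (X + s) * (i * i) - 1ℚ
    y = Y * (i * i * i)
    lemma₁ : ∀ X s μ i → μ * μ * ((X + s) * (i * i) - 1ℚ + 1ℚ) - s - X ≡ (X + s) * (μ * i + 1ℚ) * (μ * i - 1ℚ)
    lemma₁ = solve-∀ ℚ-ring
    X≡ : μ * μ * (ζ + 1ℚ) - s ≡ X
    X≡ = combine₁ ((X + s) * (μ * i + 1ℚ)) μi (lemma₁ X s μ i)
    lemma₂ : ∀ Y μ i → μ * μ * μ * (Y * (i * i * i)) - Y ≡ Y * (μ * i * (μ * i) + μ * i + 1ℚ) * (μ * i - 1ℚ)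
    lemma₂ = solve-∀ ℚ-ring
    Y≡ : μ * μ * μ * y ≡ Y
    Y≡ = combine₁ (Y * (μ * i * (μ * i) + μ * i + 1ℚ)) μi (lemma₂ Y μ i)
    k : ℚ
    k = μ * μ * μ
    Weierstrass : ℚ → ℚ → ℚ → ℚ → Set
    Weierstrass X Y A B = Y * Y ≡ X * X * X + A * X + B
    on-curve′ : Weierstrass (μ * μ * (ζ + 1ℚ) - s) (k * y) (- (3ℚ * s * s)) (k * k - 2ℚ * s * s * s)
    on-curve′ = subst₂ (λ A B → Weierstrass (μ * μ * (ζ + 1ℚ) - s) (k * y) A B) A≡-3ss B≡μ⁶-2sss
      (subst₂ (λ X Y → Weierstrass X Y A₄ B₄) (sym X≡) (sym Y≡) on-curve)
    lemma₃ : ∀ ζ y μ s → let k = μ * μ * μ; X = μ * μ * (ζ + 1ℚ) - s in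
      k * k * (y * y) - k * k * (ζ * ζ * ζ + ζ * ζ - ζ)
        ≡ 1ℚ * (k * y * (k * y) - (X * X * X + (- (ℚ[ 3 ] * s * s)) * X + (k * k - ℚ[ 2 ] * s * s * s)))
          + (- (μ * μ * μ * μ * (ζ + 1ℚ) * (ζ + 1ℚ))) * (μ * μ * (- ℚ[ 2 ]) - (- (ℚ[ 3 ] * s)))
    lemma₃ = solve-∀ ℚ-ring
    kk≢0 : k * k ≢ 0ℚ
    kk≢0 = *-≢0 {k} {k} k≢0 k≢0
      where
      k≢0 : k ≢ 0ℚ
      k≢0 = *-≢0 {μ * μ} {μ} (*-≢0 {μ} {μ} μ≢0 μ≢0) μ≢0
    curve : y * y ≡ ζ * ζ * ζ + ζ * ζ - ζ
    curve = *-cancelˡ-≢0 {k * k} (y * y) (ζ * ζ * ζ + ζ * ζ - ζ) kk≢0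
      (combine₂ 1ℚ (- (μ * μ * μ * μ * (ζ + 1ℚ) * (ζ + 1ℚ))) on-curve′ μμa₂≡-3s (lemma₃ ζ y μ s))
theorem2p8 : (a b c : ℚ) → a * b * c ≢ 0ℚ → a * c - b * b ≢ 0ℚ
    → ℚ[ 3 ] * a * c - b * b ≢ 0ℚ → ℚ[ 4 ] * a * c - b * b ≢ 0ℚ
    → (b * b ≢ (+ 3 / 2) * a * c → PositiveRank (E₄-A a b c) (E₄-B a b c))
    × (b * b ≡ (+ 3 / 2) * a * c → RankZero (E₄-A a b c) (E₄-B a b c))
theorem2p8 a b c abc≢0 _ 3ac-bb≢0 _ =
  (λ bb≢3/2ac → positive-rank a≢0 b≢0 c≢0 3ac-bb≢0 (λ 3ac≡2bb → bb≢3/2ac (combine₁ (- ½) 3ac≡2bb (lemma a b c)))) ,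
  rank-zero a≢0 b≢0
  where
  a≢0 : a ≢ 0ℚ
  a≢0 refl = abc≢0 (trans (cong (_* c) (*-zeroˡ b)) (*-zeroˡ c))
  b≢0 : b ≢ 0ℚ
  b≢0 refl = abc≢0 (trans (cong (_* c) (*-zeroʳ a)) (*-zeroˡ c))
  c≢0 : c ≢ 0ℚ
  c≢0 refl = abc≢0 (*-zeroʳ (a * b))
  lemma : ∀ a b c → b * b - (+ 3 / 2) * a * c ≡ (- ½) * (ℚ[ 3 ] * a * c - ℚ[ 2 ] * (b * b))
  lemma = solve-∀ ℚ-ring
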